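{- Let $\tau=\mathbb N$, let $\sigma$ be an arbitrary finite type, and let $t\colon\mathbb N$ be a term of system $\mathsf T$ whose only free variable is $\alpha\colon\mathbb N\to\tau$. Let $t^\circ=\langle \mathrm{Val}_{t^\circ};\mathsf B_{t^\circ}\rangle$ be the translation of $t$ and let $\Phi^{\lambda\alpha.t}$ be the term, both defined in the context, and put $\xi:=\Phi^{\lambda\alpha.t}(\mathsf B_{t^\circ})$. Then $\mathbf{HA}^\omega$ proves that $\xi$ is Spector's bar recursor for $Y=\lambda\alpha.t$: for all $G\colon\tau^*\to\sigma$, $H\colon\tau^*\to(\tau\to\sigma)\to\sigma$ and $s\colon\tau^*$, $$(\lambda\alpha.t)(\hat s)<|s|\ \to\ \xi(G,H)(s)=G(s),$$ $$(\lambda\alpha.t)(\hat s)\ge|s|\ \to\ \xi(G,H)(s)=H(s)(\lambda x^\tau.\,\xi(G,H)(s*x)).$$ Moreover, if $t\in\mathsf T_i$ then $\Phi^{\lambda\alpha.t}(\mathsf B_{t^\circ})\in\mathsf T_j$, where $j=2+\max\{1,\mathrm{level}(\sigma)\}+i$.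
   Context: Finite types: $\mathbb N$ is a finite type, and if $\tau_0,\tau_1$ are finite types then so are $\tau_0\to\tau_1$ (also written $\tau_1^{\tau_0}$) and $\tau_0^*$ (finite sequences); finite products $\tau\times\sigma$, with pairs $\langle s;t\rangle$, are used as a definitional extension. Type levels: $\mathrm{level}(\mathbb N)=0$, $\mathrm{level}(\rho\to\eta)=\max\{\mathrm{level}(\rho)+1,\mathrm{level}(\eta)\}$, $\mathrm{level}(\tau\times\sigma)=\max\{\mathrm{level}(\tau),\mathrm{level}(\sigma)\}$, $\mathrm{level}(\tau^*)=\mathrm{level}(\tau)$. System $\mathsf T$ is the simply typed $\lambda$-calculus with $0$, $\mathsf{Succ}$ and recursors $\mathsf{Rec}^\rho$ for every finite type $\rho$, with $\mathsf{Rec}^\rho(a,f)(0)=a$, $\mathsf{Rec}^\rho(a,f)(\mathsf{Succ}(m))=f(m,\mathsf{Rec}^\rho(a,f)(m))$. $\mathsf T_i$ is the fragment in which $\mathsf{Rec}^\rho$ is restricted to $\mathrm{level}(\rho)\le i$. $\mathbf{HA}^\omega$ is intuitionistic Heyting arithmetic in all finite types. Notation: $|s|$ is the length of $s\colon\tau^*$; $s*x$ is $s$ with $x\colon\tau$ appended; $\hat s\colon\mathbb N\to\tau$ extends $s$ by infinitely many zero objects $0^\tau$. The term $\Psi$. Define by primitive recursion $\varphi(G,H)(0)=G$ and, for $n>0$, $\varphi(G,H)(n)=\lambda s^{\tau^*}.H(s)(\lambda x^\tau.\varphi(G,H)(n-1)(s*x))$. For $k\colon\mathbb N$ put $\Psi(k)(G,H)(s)=G(s)$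 if $|s|>k$, and $\Psi(k)(G,H)(s)=\varphi(G,H)(k+1-|s|)(s)$ if $|s|\le k$. The term $\Phi^Y$. For a closed term $Y\colon\tau^{\mathbb N}\to\mathbb N$ let $\mathcal H^Y(G,H)(s)(f^{\tau\to\sigma})=G(s)$ if $Y(\hat s)<|s|$, and $=H(s)(f)$ otherwise. For $\Delta\colon(\tau^*\to\sigma)\to(\tau^*\to(\tau\to\sigma)\to\sigma)\to\tau^*\to\sigma$ put $$\Phi^Y(\Delta)(G,H)(s)=\Delta\big(\lambda s'.\Psi(Y(\widehat{s'}))(G,H)(s'),\ \mathcal H^Y(G,H)\big)(s).$$ Translation of types (built from $\mathbb N$ and $\to$): $\mathbb N^\circ=(\tau^{\mathbb N}\to\mathbb N)\times\big((\tau^*\to\sigma)\to(\tau^*\to(\tau\to\sigma)\to\sigma)\to\tau^*\to\sigma\big)$ and $(\rho_0\to\rho_1)^\circ=\rho_0^\circ\to\rho_1^\circ$. For $u\colon\mathbb N^\circ$ write $u=\langle\mathrm{Val}_u;\mathsf B_u\rangle$. Translation of terms ($\tau=\mathbb N$). The term $t$ and its subterms have types built from $\mathbb N$ and $\to$. $\alpha$ is a special variable of type $\mathbb N\to\mathbb N$ (not treated as an ordinary variable); each ordinary variable $x\colon\eta$ is mapped to a variable $x^\circ\colon\eta^\circ$. A term $t\colon\rho$ is translated to $t^\circ\colon\rho^\circ$ by: - $0^\circ=\langle\lambda\alpha.0;\ \lambda G,H.G\rangle$; - $\mathsf{Succ}^\circ=\lambda x^{\mathbb N^\circ}.\langle\lambda\alpha.\mathsf{Succ}(\mathrm{Val}_x(\alpha));\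 \mathsf B_x\rangle$; - $\alpha^\circ=\lambda x^{\mathbb N^\circ}.\langle\lambda\alpha.\alpha(\mathrm{Val}_x(\alpha));\ \lambda G,H.\,\mathsf B_x(\lambda s'.\Psi(\mathrm{Val}_x(\widehat{s'}))(G,H)(s'),H)\rangle$; - $(x^\eta)^\circ=x^\circ$; $(\lambda x^\eta.t)^\circ=\lambda x^\circ.t^\circ$; $(uv)^\circ=u^\circ v^\circ$; - for $\eta=\rho\to\mathbb N$ (with $\rho$ standing for a tuple of argument types when there are several, $v$ then being the corresponding tuple of variables, and with $\rho$ and $v$ omitted if $\eta=\mathbb N$): $(\mathsf{Rec}^\eta)^\circ=\lambda a^{\eta^\circ},F^{\mathbb N^\circ\to\eta^\circ\to\eta^\circ},x^{\mathbb N^\circ},v^{\rho^\circ}.\langle\lambda\alpha.\mathrm{Val}_{r[\mathrm{Val}_x(\alpha)]}(\alpha);\ \mathsf B\rangle$, where $r[n]=\mathsf{Rec}^{\eta^\circ}(a,\lambda k^{\mathbb N}.F(k^\circ))(n)(v)$, $k^\circ=\langle\lambda\alpha.k;\lambda G,H.G\rangle$ and $\mathsf B(G,H)(s)=\mathsf B_x(\lambda s'.\mathsf B_{r[\mathrm{Val}_x(\widehat{s'})]}(G,H)(s'),H)(s)$.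
   Formalization: HA^ω is taken with full extensionality (equality primitive at all types, pointwise equal functionals equal); without it the second equation can fail, since H may distinguish extensionally equal arguments, e.g. in HRO. -}

module Defs where

open import Data.Nat using (ℕ; zero; suc; _⊔_; _≤_)
open import Data.List using (List; []; _∷_; [_]; _++_; map)
open import Data.List.Membership.Propositional using (_∈_)
open import Data.List.Membership.Propositional.Properties using (∈-map⁺; ∈-++⁻)
open import Data.List.Relation.Binary.Subset.Propositional using (_⊆_)
open import Data.List.Relation.Unary.Any using (here; there)
open import Data.Product using (_×_)
open import Data.Sum using (inj₁; inj₂)
open import Data.Unit using (⊤)
open import Relation.Binary.PropositionalEquality using (refl)

infixr 7 _⇒_ _⇒ᵖ_
infixr 8 _⊗_
infix  9 _✶

data Ty : Set where
  nat : Ty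
  _⇒_ : Ty → Ty → Ty
  _⊗_ : Ty → Ty → Ty
  _✶  : Ty → Ty          -- finite sequences

level : Ty → ℕ
level nat     = 0
level (A ⇒ B) = suc (level A) ⊔ level B
level (A ⊗ B) = level A ⊔ level B
level (A ✶)   = level A

data Pure : Ty → Set where
  natᵖ : Pure nat
  _⇒ᵖ_ : ∀ {A B} → Pure A → Pure B → Pure (A ⇒ B)

Cxt : Set
Cxt = List Ty

-- Sequences are built by appending at the end.  `hat` is the extension of
-- a finite sequence by zero objects; `len` and `hat` are constants, so the
-- only recursors are the `rec A`.
data Con : Ty → Set where
  zero : Con nat
  suc  : Con (nat ⇒ nat)
  rec  : ∀ A → Con (A ⇒ (nat ⇒ A ⇒ A) ⇒ nat ⇒ A)
  pair : ∀ {A B} → Con (A ⇒ B ⇒ A ⊗ B)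
  fst  : ∀ {A B} → Con (A ⊗ B ⇒ A)
  snd  : ∀ {A B} → Con (A ⊗ B ⇒ B)
  nil  : ∀ {A} → Con (A ✶)
  snoc : ∀ {A} → Con (A ✶ ⇒ A ⇒ A ✶)
  len  : ∀ {A} → Con (A ✶ ⇒ nat)
  hat  : ∀ {A} → Con (A ✶ ⇒ nat ⇒ A)

infixl 10 _·_ _·ᵖ_

data Tm (Γ : Cxt) : Ty → Set where
  var : ∀ {A} → A ∈ Γ → Tm Γ A
  lam : ∀ {A B} → Tm (A ∷ Γ) B → Tm Γ (A ⇒ B)
  _·_ : ∀ {A B} → Tm Γ (A ⇒ B) → Tm Γ A → Tm Γ B
  con : ∀ {A} → Con A → Tm Γ A

liftRen : ∀ {Γ Δ : Cxt} {A} → Γ ⊆ Δ → (A ∷ Γ) ⊆ (A ∷ Δ)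
liftRen ρ (here p)  = here p
liftRen ρ (there x) = there (ρ x)

ren : ∀ {Γ Δ : Cxt} {A} → Γ ⊆ Δ → Tm Γ A → Tm Δ A
ren ρ (var x) = var (ρ x)
ren ρ (lam t) = lam (ren (liftRen ρ) t)
ren ρ (t · u) = ren ρ t · ren ρ u
ren ρ (con c) = con c

wk : ∀ {Γ A B} → Tm Γ A → Tm (B ∷ Γ) A
wk = ren there

closed : ∀ {Γ A} → Tm [] A → Tm Γ A
closed = ren λ ()

Sub : Cxt → Cxt → Set
Sub Γ Δ = ∀ {A} → A ∈ Γ → Tm Δ A

liftSub : ∀ {Γ Δ A} → Sub Γ Δ → Sub (A ∷ Γ) (A ∷ Δ)
liftSub θ (here p)  = var (here p)
liftSub θ (there x) = wk (θ x)

sub : ∀ {Γ Δ A} → Sub Γ Δ → Tm Γ A → Tm Δ A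
sub θ (var x) = θ x
sub θ (lam t) = lam (sub (liftSub θ) t)
sub θ (t · u) = sub θ t · sub θ u
sub θ (con c) = con c

single : ∀ {Γ A} → Tm Γ A → Sub (A ∷ Γ) Γ
single u (here refl) = u
single u (there x)   = var x

infix 11 _[_]ᵗ

_[_]ᵗ : ∀ {Γ A B} → Tm (A ∷ Γ) B → Tm Γ A → Tm Γ B
t [ u ]ᵗ = sub (single u) t

infix 4 _∈T_ _∈Tᶜ_

_∈Tᶜ_ : ∀ {A} → Con A → ℕ → Set
rec A ∈Tᶜ i = level A ≤ i
_     ∈Tᶜ i = ⊤

_∈T_ : ∀ {Γ A} → Tm Γ A → ℕ → Set
var x   ∈T i = ⊤
lam t   ∈T i = t ∈T i
(t · u) ∈T i = (t ∈T i) × (u ∈T i)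
con c   ∈T i = c ∈Tᶜ i

-- Every subterm (the term itself included) has a pure type.
data PureTm {Γ : Cxt} : ∀ {A} → Tm Γ A → Set where
  varᵖ  : ∀ {A} → Pure A → (x : A ∈ Γ) → PureTm (var x)
  lamᵖ  : ∀ {A B} {t : Tm (A ∷ Γ) B} → Pure A → PureTm t → PureTm (lam t)
  _·ᵖ_  : ∀ {A B} {t : Tm Γ (A ⇒ B)} {u : Tm Γ A} →
          PureTm t → PureTm u → PureTm (t · u)
  zeroᵖ : PureTm (con zero)
  sucᵖ  : PureTm (con suc)
  recᵖ  : ∀ {A} → Pure A → PureTm (con (rec A))

pattern v₀ = var (here refl)
pattern v₁ = var (there (here refl))
pattern v₂ = var (there (there (here refl)))
pattern v₃ = var (there (there (there (here refl))))
pattern v₄ = var (there (there (there (there (here refl)))))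
pattern v₅ = var (there (there (there (there (there (here refl))))))

⟨_⨾_⟩ : ∀ {Γ A B} → Tm Γ A → Tm Γ B → Tm Γ (A ⊗ B)
⟨ a ⨾ b ⟩ = con pair · a · b

∣_∣ : ∀ {Γ A} → Tm Γ (A ✶) → Tm Γ nat
∣ s ∣ = con len · s

infixl 9 _∗_

_∗_ : ∀ {Γ A} → Tm Γ (A ✶) → Tm Γ A → Tm Γ (A ✶)
s ∗ x = con snoc · s · x

infix 11 _^

_^ : ∀ {Γ A} → Tm Γ (A ✶) → Tm Γ (nat ⇒ A)
s ^ = con hat · s

zeroObj : ∀ {Γ} A → Tm Γ A
zeroObj nat     = con zero
zeroObj (A ⇒ B) = lam (zeroObj B)
zeroObj (A ⊗ B) = ⟨ zeroObj A ⨾ zeroObj B ⟩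
zeroObj (A ✶)   = con nil

plus : ∀ {Γ} → Tm Γ (nat ⇒ nat ⇒ nat)
plus = lam {- m -} (lam {- n -}
  (con (rec nat) · v₁ · lam (lam (con suc · v₀)) · v₀))

pred : ∀ {Γ} → Tm Γ (nat ⇒ nat)
pred = lam (con (rec nat) · con zero · lam (lam v₁) · v₀)

monus : ∀ {Γ} → Tm Γ (nat ⇒ nat ⇒ nat)
monus = lam {- m -} (lam {- n -}
  (con (rec nat) · v₁ · lam (lam (pred · v₀)) · v₀))

ifZero : ∀ {Γ A} → Tm Γ (nat ⇒ A ⇒ A ⇒ A)
ifZero {A = A} = lam {- b -} (lam {- u -} (lam {- v -}
  (con (rec A) · v₁ · lam (lam v₂) · v₂)))

-- Zero exactly when m < n.
ltTest : ∀ {Γ} → Tm Γ nat → Tm Γ nat → Tm Γ nat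
ltTest m n = monus · (con suc · m) · n

infix  6 _≐_
infixr 5 _∧_
infixr 4 _∨_
infixr 3 _⊃_

data Fm (Γ : Cxt) : Set where
  _≐_ : ∀ {A} → Tm Γ A → Tm Γ A → Fm Γ
  ⊥′  : Fm Γ
  _∧_ : Fm Γ → Fm Γ → Fm Γ
  _∨_ : Fm Γ → Fm Γ → Fm Γ
  _⊃_ : Fm Γ → Fm Γ → Fm Γ
  ∀′  : ∀ A → Fm (A ∷ Γ) → Fm Γ
  ∃′  : ∀ A → Fm (A ∷ Γ) → Fm Γ

renF : ∀ {Γ Δ : Cxt} → Γ ⊆ Δ → Fm Γ → Fm Δ
renF ρ (t ≐ u)  = ren ρ t ≐ ren ρ u
renF ρ ⊥′       = ⊥′
renF ρ (φ ∧ ψ)  = renF ρ φ ∧ renF ρ ψ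
renF ρ (φ ∨ ψ)  = renF ρ φ ∨ renF ρ ψ
renF ρ (φ ⊃ ψ)  = renF ρ φ ⊃ renF ρ ψ
renF ρ (∀′ A φ) = ∀′ A (renF (liftRen ρ) φ)
renF ρ (∃′ A φ) = ∃′ A (renF (liftRen ρ) φ)

wkF : ∀ {Γ A} → Fm Γ → Fm (A ∷ Γ)
wkF = renF there

subF : ∀ {Γ Δ} → Sub Γ Δ → Fm Γ → Fm Δ
subF θ (t ≐ u)  = sub θ t ≐ sub θ u
subF θ ⊥′       = ⊥′
subF θ (φ ∧ ψ)  = subF θ φ ∧ subF θ ψ
subF θ (φ ∨ ψ)  = subF θ φ ∨ subF θ ψ
subF θ (φ ⊃ ψ)  = subF θ φ ⊃ subF θ ψ
subF θ (∀′ A φ) = ∀′ A (subF (liftSub θ) φ)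
subF θ (∃′ A φ) = ∃′ A (subF (liftSub θ) φ)

infix 11 _[_]ᶠ

_[_]ᶠ : ∀ {Γ A} → Fm (A ∷ Γ) → Tm Γ A → Fm Γ
φ [ u ]ᶠ = subF (single u) φ

infix 6 _≺_ _≽_

_≽_ : ∀ {Γ} → Tm Γ nat → Tm Γ nat → Fm Γ
m ≽ n = ∃′ nat (plus · wk n · v₀ ≐ wk m)

_≺_ : ∀ {Γ} → Tm Γ nat → Tm Γ nat → Fm Γ
m ≺ n = n ≽ con suc · m

-- Induction steps replace variable 0 by its successor (for ℕ), and s by
-- s ∗ x  in a context extended with a fresh x (for sequences).
sucSub : ∀ {Γ} → Sub (nat ∷ Γ) (nat ∷ Γ)
sucSub (here refl) = con suc · v₀
sucSub (there x)   = var (there x)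

snocSub : ∀ {Γ A} → Sub (A ✶ ∷ Γ) (A ∷ A ✶ ∷ Γ)
snocSub (here refl) = v₁ ∗ v₀
snocSub (there x)   = var (there (there x))

infix 2 _⊢_

-- HAω over System T.  Equality is primitive at every type, with Leibniz
-- substitution, and extensional at function types: without extensionality a
-- functional H could separate extensionally equal arguments, and the
-- defining equations of bar recursion could not be transferred under λ.
data _⊢_ {Γ : Cxt} (Δ : List (Fm Γ)) : Fm Γ → Set where
  hyp : ∀ {φ} → φ ∈ Δ → Δ ⊢ φ
  ⊥E  : ∀ {φ} → Δ ⊢ ⊥′ → Δ ⊢ φ
  ∧I  : ∀ {φ ψ} → Δ ⊢ φ → Δ ⊢ ψ → Δ ⊢ φ ∧ ψ
  ∧E₁ : ∀ {φ ψ} → Δ ⊢ φ ∧ ψ → Δ ⊢ φ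
  ∧E₂ : ∀ {φ ψ} → Δ ⊢ φ ∧ ψ → Δ ⊢ ψ
  ∨I₁ : ∀ {φ ψ} → Δ ⊢ φ → Δ ⊢ φ ∨ ψ
  ∨I₂ : ∀ {φ ψ} → Δ ⊢ ψ → Δ ⊢ φ ∨ ψ
  ∨E  : ∀ {φ ψ χ} → Δ ⊢ φ ∨ ψ → φ ∷ Δ ⊢ χ → ψ ∷ Δ ⊢ χ → Δ ⊢ χ
  ⊃I  : ∀ {φ ψ} → φ ∷ Δ ⊢ ψ → Δ ⊢ φ ⊃ ψ
  ⊃E  : ∀ {φ ψ} → Δ ⊢ φ ⊃ ψ → Δ ⊢ φ → Δ ⊢ ψ
  ∀I  : ∀ {A φ} → map wkF Δ ⊢ φ → Δ ⊢ ∀′ A φ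
  ∀E  : ∀ {A φ} → Δ ⊢ ∀′ A φ → (t : Tm Γ A) → Δ ⊢ φ [ t ]ᶠ
  ∃I  : ∀ {A φ} (t : Tm Γ A) → Δ ⊢ φ [ t ]ᶠ → Δ ⊢ ∃′ A φ
  ∃E  : ∀ {A φ ψ} → Δ ⊢ ∃′ A φ → φ ∷ map wkF Δ ⊢ wkF ψ → Δ ⊢ ψ

  ≐refl : ∀ {A} {t : Tm Γ A} → Δ ⊢ t ≐ t
  ≐subst : ∀ {A} {t u : Tm Γ A} (φ : Fm (A ∷ Γ)) →
           Δ ⊢ t ≐ u → Δ ⊢ φ [ t ]ᶠ → Δ ⊢ φ [ u ]ᶠ
  ≐ext  : ∀ {A B} {t u : Tm Γ (A ⇒ B)} →
          Δ ⊢ ∀′ A (wk t · v₀ ≐ wk u · v₀) → Δ ⊢ t ≐ u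
  β     : ∀ {A B} {t : Tm (A ∷ Γ) B} {u : Tm Γ A} →
          Δ ⊢ lam t · u ≐ t [ u ]ᵗ

  rec-zero : ∀ {A} {a : Tm Γ A} {f} →
             Δ ⊢ con (rec A) · a · f · con zero ≐ a
  rec-suc  : ∀ {A} {a : Tm Γ A} {f n} →
             Δ ⊢ con (rec A) · a · f · (con suc · n)
                   ≐ f · n · (con (rec A) · a · f · n)
  suc≢zero : ∀ {n : Tm Γ nat} → Δ ⊢ con suc · n ≐ con zero ⊃ ⊥′
  suc-inj  : ∀ {m n : Tm Γ nat} → Δ ⊢ con suc · m ≐ con suc · n ⊃ m ≐ n
  nat-ind  : (φ : Fm (nat ∷ Γ)) → Δ ⊢ φ [ con zero ]ᶠ →
             Δ ⊢ ∀′ nat (φ ⊃ subF sucSub φ) → Δ ⊢ ∀′ nat φ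

  fst-pair : ∀ {A B} {a : Tm Γ A} {b : Tm Γ B} →
             Δ ⊢ con fst · ⟨ a ⨾ b ⟩ ≐ a
  snd-pair : ∀ {A B} {a : Tm Γ A} {b : Tm Γ B} →
             Δ ⊢ con snd · ⟨ a ⨾ b ⟩ ≐ b
  pair-η   : ∀ {A B} {p : Tm Γ (A ⊗ B)} →
             Δ ⊢ ⟨ con fst · p ⨾ con snd · p ⟩ ≐ p

  len-nil  : ∀ {A} → Δ ⊢ ∣ con (nil {A}) ∣ ≐ con zero
  len-snoc : ∀ {A} {s : Tm Γ (A ✶)} {x : Tm Γ A} →
             Δ ⊢ ∣ s ∗ x ∣ ≐ con suc · ∣ s ∣
  hat-nil  : ∀ {A n} → Δ ⊢ con (nil {A}) ^ · n ≐ zeroObj A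
  hat-last : ∀ {A} {s : Tm Γ (A ✶)} {x : Tm Γ A} →
             Δ ⊢ (s ∗ x) ^ · ∣ s ∣ ≐ x
  hat-init : ∀ {A} {s : Tm Γ (A ✶)} {x : Tm Γ A} {n} →
             Δ ⊢ (n ≐ ∣ s ∣ ⊃ ⊥′) ⊃ (s ∗ x) ^ · n ≐ s ^ · n
  seq-ind  : ∀ {A} (φ : Fm (A ✶ ∷ Γ)) → Δ ⊢ φ [ con nil ]ᶠ →
             Δ ⊢ ∀′ (A ✶) (∀′ A (wkF φ ⊃ subF snocSub φ)) →
             Δ ⊢ ∀′ (A ✶) φ

module BarRecursion (τ σ : Ty) where

  𝔾 ℍ 𝔹 : Ty
  𝔾 = τ ✶ ⇒ σ
  ℍ = τ ✶ ⇒ (τ ⇒ σ) ⇒ σ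
  𝔹 = 𝔾 ⇒ ℍ ⇒ τ ✶ ⇒ σ

  φ-term : ∀ {Γ} → Tm Γ (𝔾 ⇒ ℍ ⇒ nat ⇒ τ ✶ ⇒ σ)
  φ-term = lam {- G -} (lam {- H -}
    (con (rec (τ ✶ ⇒ σ)) · v₁
      · lam {- n -} (lam {- f -} (lam {- s -}
          (v₃ · v₀ · lam {- x -} (v₂ · (v₁ ∗ v₀)))))))

  Ψ : ∀ {Γ} → Tm Γ (nat ⇒ 𝔾 ⇒ ℍ ⇒ τ ✶ ⇒ σ)
  Ψ = lam {- k -} (lam {- G -} (lam {- H -} (lam {- s -}
    (ifZero · ltTest v₃ ∣ v₀ ∣
            · (v₂ · v₀)
            · (φ-term · v₂ · v₁ · (monus · (con suc · v₃) · ∣ v₀ ∣) · v₀)))))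

  𝓗 : ∀ {Γ} → Tm [] ((nat ⇒ τ) ⇒ nat) → Tm Γ (𝔾 ⇒ ℍ ⇒ ℍ)
  𝓗 Y = lam {- G -} (lam {- H -} (lam {- s -} (lam {- f -}
    (ifZero · ltTest (closed Y · v₁ ^) ∣ v₁ ∣
            · (v₃ · v₁)
            · (v₂ · v₁ · v₀)))))

  Φ : Tm [] ((nat ⇒ τ) ⇒ nat) → Tm [] (𝔹 ⇒ 𝔹)
  Φ Y = lam {- Δ -} (lam {- G -} (lam {- H -} (lam {- s -}
    (v₃ · lam {- s′ -} (Ψ · (closed Y · v₀ ^) · v₃ · v₂ · v₀)
        · (𝓗 Y · v₂ · v₁)
        · v₀))))

  SpectorBR : Tm [] ((nat ⇒ τ) ⇒ nat) → Tm [] 𝔹 → Fm []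
  SpectorBR Y ξ = ∀′ 𝔾 {- G -} (∀′ ℍ {- H -} (∀′ (τ ✶) {- s -}
    ( (closed Y · v₀ ^ ≺ ∣ v₀ ∣
        ⊃ closed ξ · v₂ · v₁ · v₀ ≐ v₂ · v₀)
    ∧ (closed Y · v₀ ^ ≽ ∣ v₀ ∣
        ⊃ closed ξ · v₂ · v₁ · v₀
            ≐ v₁ · v₀ · lam {- x -} (closed ξ · v₃ · v₂ · (v₁ ∗ v₀))))))

  infix 12 _°

  -- Only the values at types built from ℕ and → matter; the last two
  -- clauses merely make the function total.
  _° : Ty → Ty
  nat °     = ((nat ⇒ τ) ⇒ nat) ⊗ 𝔹
  (A ⇒ B) ° = A ° ⇒ B °
  (A ⊗ B) ° = A ° ⊗ B °
  (A ✶) °   = (A °) ✶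

  Val : ∀ {Γ} → Tm Γ (nat °) → Tm Γ ((nat ⇒ τ) ⇒ nat)
  Val u = con fst · u

  𝖡 : ∀ {Γ} → Tm Γ (nat °) → Tm Γ 𝔹
  𝖡 u = con snd · u

module Translation (σ : Ty) where

  open BarRecursion nat σ public

  numᵒ : ∀ {Γ} → Tm Γ (nat ⇒ nat °)
  numᵒ = lam {- k -} ⟨ lam {- α -} v₁ ⨾ lam {- G -} (lam {- H -} v₁) ⟩

  zeroᵒ : ∀ {Γ} → Tm Γ (nat °)
  zeroᵒ = ⟨ lam {- α -} (con zero) ⨾ lam {- G -} (lam {- H -} v₁) ⟩

  sucᵒ : ∀ {Γ} → Tm Γ ((nat ⇒ nat) °)
  sucᵒ = lam {- x -} ⟨ lam {- α -} (con suc · (Val v₁ · v₀)) ⨾ 𝖡 v₀ ⟩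

  αᵒ : ∀ {Γ} → Tm Γ ((nat ⇒ nat) °)
  αᵒ = lam {- x -}
    ⟨ lam {- α -} (v₀ · (Val v₁ · v₀))
    ⨾ lam {- G -} (lam {- H -}
        (𝖡 v₂ · lam {- s′ -} (Ψ · (Val v₃ · v₀ ^) · v₂ · v₁ · v₀) · v₀))
    ⟩

  -- The body of the translated recursor, as a function of x and of
  -- r = λn. r[n], where r[n] = Rec(a, λk. F(k°))(n)(v).  The arguments v of η = ρ → ℕ are taken one at a time,
  -- each being absorbed into r.
  recBody : ∀ {Γ η} → Pure η → Tm Γ (nat ° ⇒ (nat ⇒ η °) ⇒ η °)
  recBody natᵖ = lam {- x -} (lam {- r -}
    ⟨ lam {- α -} (Val (v₁ · (Val v₂ · v₀)) · v₀)
    ⨾ lam {- G -} (lam {- H -} (lam {- s -}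
        (𝖡 v₄ · lam {- s′ -}
                  (𝖡 (v₄ · (Val v₅ · v₀ ^)) · v₃ · v₂ · v₀)
              · v₁ · v₀)))
    ⟩)
  recBody (p ⇒ᵖ q) = lam {- x -} (lam {- r -} (lam {- v -}
    (recBody q · v₂ · lam {- n -} (v₂ · v₀ · v₁))))

  recᵒ : ∀ {Γ η} → Pure η →
         Tm Γ ((η ⇒ (nat ⇒ η ⇒ η) ⇒ nat ⇒ η) °)
  recᵒ {η = η} p = lam {- a -} (lam {- F -} (lam {- x -}
    (recBody p · v₀
      · lam {- n -} (con (rec (η °)) · v₃ · lam {- k -} (v₃ · (numᵒ · v₀)) · v₀))))

  -- Γ lists the ordinary variables; the special variable α is the last
  -- one of the context, hence never bound inside the term.
  translate : ∀ Γ {A} {t : Tm (Γ ++ [ nat ⇒ nat ]) A} →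
              PureTm t → Tm (map _° Γ) (A °)
  translate Γ (varᵖ _ x) with ∈-++⁻ Γ x
  ... | inj₁ y           = var (∈-map⁺ _° y)
  ... | inj₂ (here refl) = αᵒ
  translate Γ (lamᵖ {A = A} _ p) = lam (translate (A ∷ Γ) p)
  translate Γ (p ·ᵖ q)           = translate Γ p · translate Γ q
  translate Γ zeroᵖ              = zeroᵒ
  translate Γ sucᵖ               = sucᵒ
  translate Γ (recᵖ p)           = recᵒ p

{-# OPTIONS --safe #-}

-- Call u : ℕ° good if, for all G, H and s, either Val u is constant on the
-- extensions of s and 𝖡 u G H agrees with G on them, or 𝖡 u G H satisfies the
-- equation of bar recursion at s.  Let u be good and apply this to
-- G⁺ = λ s′. Ψ (Val u ŝ′) G H s′ and to 𝓗 G H.  In the first case 𝖡 u G⁺ (𝓗 G H)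
-- is Ψ n G H for the fixed n = Val u ŝ on all extensions of s, and Ψ n
-- satisfies Spector's equations at s as long as n does not vary; in the second
-- case 𝓗 is unfolded.  Hence Φ turns 𝖡 u into Spector's bar recursor for Val u.
--
-- That t° is good and that Val t° α = t follow from a logical relation between
-- terms and their translations whose clause at ℕ is  a = Val u α ∧ Good u.  The
-- recursor needs an induction inside HAω; it is available because goodness is a
-- single formula: the case distinction depends on G, H and s, so no securing
-- bar has to be chosen for each stage of the recursion.

module Submission where

open import Data.Nat using (ℕ; zero; suc; _+_; _⊔_; _≤_; z≤n; s≤s)
open import Data.Nat.Properties
  using (≤-refl; ≤-reflexive; ≤-trans; n≤1+n; m≤n⇒m≤1+n; m≤m+n; m≤n+m; +-suc; +-monoʳ-≤;
         m≤m⊔n; m≤n⊔m; ⊔-lub)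
open import Data.List using (List; []; _∷_; [_]; _++_; map)
open import Data.List.Membership.Propositional using (_∈_)
open import Data.List.Membership.Propositional.Properties using (∈-map⁺; ∈-map⁻; ∈-++⁻)
open import Data.List.Relation.Binary.Subset.Propositional using (_⊆_)
open import Data.List.Relation.Unary.All using (All; []; _∷_)
open import Data.List.Relation.Unary.All.Properties using (++⁻ˡ; ++⁻ʳ)
open import Data.List.Relation.Unary.Any using (here; there)
open import Data.Maybe using (Maybe; just; nothing)
open import Data.Product using (Σ; _×_; _,_; proj₁; proj₂)
open import Data.Sum using (inj₁; inj₂)
open import Data.Unit using (tt)
open import Function using (_∘_; id)
open import Relation.Binary.PropositionalEquality using (_≡_; refl; sym; trans; cong; cong₂; subst)
open import Defs

private variable
  Γ Γ′ Γ″ : Cxt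
  A B η : Ty
  Δ : List (Fm Γ)

pattern v₆ = var (there (there (there (there (there (there (here refl)))))))

pattern h₀ = hyp (here refl)
pattern h₁ = hyp (there (here refl))
pattern h₂ = hyp (there (there (here refl)))

-- Renaming and substitution

-- Substitutions are functions and are compared pointwise, so function extensionality is never
-- assumed.
sub-cong : {θ θ′ : Sub Γ Γ′} → (∀ {A} (x : A ∈ Γ) → θ x ≡ θ′ x) →
           (t : Tm Γ A) → sub θ t ≡ sub θ′ t
sub-cong e (var x) = e x
sub-cong e (lam t) = cong lam (sub-cong (λ { (here refl) → refl ; (there x) → cong wk (e x) }) t)
sub-cong e (t · u) = cong₂ _·_ (sub-cong e t) (sub-cong e u)
sub-cong e (con c) = refl

sub-var : {θ : Sub Γ Γ} → (∀ {A} (x : A ∈ Γ) → θ x ≡ var x) →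
          (t : Tm Γ A) → sub θ t ≡ t
sub-var e (var x) = e x
sub-var e (lam t) = cong lam (sub-var (λ { (here refl) → refl ; (there x) → cong wk (e x) }) t)
sub-var e (t · u) = cong₂ _·_ (sub-var e t) (sub-var e u)
sub-var e (con c) = refl

ren-as-sub : (ρ : Γ ⊆ Γ′) (t : Tm Γ A) → ren ρ t ≡ sub (var ∘ ρ) t
ren-as-sub ρ (var x) = refl
ren-as-sub ρ (lam t) = cong lam (trans (ren-as-sub (liftRen ρ) t)
  (sub-cong (λ { (here refl) → refl ; (there x) → refl }) t))
ren-as-sub ρ (t · u) = cong₂ _·_ (ren-as-sub ρ t) (ren-as-sub ρ u)
ren-as-sub ρ (con c) = refl

sub-ren : (θ : Sub Γ′ Γ″) (ρ : Γ ⊆ Γ′) (t : Tm Γ A) → sub θ (ren ρ t) ≡ sub (θ ∘ ρ) t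
sub-ren θ ρ (var x) = refl
sub-ren θ ρ (lam t) = cong lam (trans (sub-ren (liftSub θ) (liftRen ρ) t)
  (sub-cong (λ { (here refl) → refl ; (there x) → refl }) t))
sub-ren θ ρ (t · u) = cong₂ _·_ (sub-ren θ ρ t) (sub-ren θ ρ u)
sub-ren θ ρ (con c) = refl

ren-ren : (π : Γ′ ⊆ Γ″) (ρ : Γ ⊆ Γ′) (t : Tm Γ A) → ren π (ren ρ t) ≡ ren (π ∘ ρ) t
ren-ren π ρ t = trans (ren-as-sub π (ren ρ t))
  (trans (sub-ren (var ∘ π) ρ t) (sym (ren-as-sub (π ∘ ρ) t)))

ren-sub : (ρ : Γ′ ⊆ Γ″) (θ : Sub Γ Γ′) (t : Tm Γ A) → ren ρ (sub θ t) ≡ sub (ren ρ ∘ θ) t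
ren-sub ρ θ (var x) = refl
ren-sub ρ θ (lam t) = cong lam (trans (ren-sub (liftRen ρ) (liftSub θ) t)
  (sub-cong (λ { (here refl) → refl
               ; (there x) → trans (ren-ren (liftRen ρ) there (θ x)) (sym (ren-ren there ρ (θ x))) }) t))
ren-sub ρ θ (t · u) = cong₂ _·_ (ren-sub ρ θ t) (ren-sub ρ θ u)
ren-sub ρ θ (con c) = refl

sub-wk : (θ : Sub Γ Γ′) (t : Tm Γ A) → sub (liftSub {A = B} θ) (wk t) ≡ wk (sub θ t)
sub-wk θ t = trans (sub-ren (liftSub θ) there t) (sym (ren-sub there θ t))

sub-sub : (η : Sub Γ′ Γ″) (θ : Sub Γ Γ′) (t : Tm Γ A) → sub η (sub θ t) ≡ sub (sub η ∘ θ) t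
sub-sub η θ (var x) = refl
sub-sub η θ (lam t) = cong lam (trans (sub-sub (liftSub η) (liftSub θ) t)
  (sub-cong (λ { (here refl) → refl ; (there x) → sub-wk η (θ x) }) t))
sub-sub η θ (t · u) = cong₂ _·_ (sub-sub η θ t) (sub-sub η θ u)
sub-sub η θ (con c) = refl

single-wk : (u : Tm Γ B) (t : Tm Γ A) → sub (single u) (wk t) ≡ t
single-wk u t = trans (sub-ren (single u) there t) (sub-var (λ _ → refl) t)

ren-closed : (ρ : Γ ⊆ Γ′) (t : Tm [] A) → ren ρ (closed t) ≡ closed t
ren-closed ρ t = trans (ren-ren ρ _ t) (trans (ren-as-sub _ t)
  (trans (sub-cong (λ ()) t) (sym (ren-as-sub _ t))))

closed-[] : (t : Tm [] A) → closed t ≡ t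
closed-[] t = trans (ren-as-sub _ t) (sub-var (λ ()) t)

sub-[] : (θ : Sub Γ Γ′) (t : Tm (B ∷ Γ) A) (u : Tm Γ B) →
         sub θ (t [ u ]ᵗ) ≡ sub (liftSub θ) t [ sub θ u ]ᵗ
sub-[] θ t u = trans (sub-sub θ (single u) t) (trans
  (sub-cong (λ { (here refl) → refl ; (there x) → sym (single-wk (sub θ u) (θ x)) }) t)
  (sym (sub-sub (single (sub θ u)) (liftSub θ) t)))

wk-[v₀] : (t : Tm (B ∷ Γ) A) → ren (liftRen there) t [ v₀ ]ᵗ ≡ t
wk-[v₀] t = trans (sub-ren (single v₀) (liftRen there) t)
  (sub-var (λ { (here refl) → refl ; (there x) → refl }) t)

sub-zeroObj : (θ : Sub Γ Γ′) → ∀ A → sub θ (zeroObj A) ≡ zeroObj A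
sub-zeroObj θ nat     = refl
sub-zeroObj θ (A ⇒ B) = cong lam (sub-zeroObj (liftSub θ) B)
sub-zeroObj θ (A ⊗ B) = cong₂ ⟨_⨾_⟩ (sub-zeroObj θ A) (sub-zeroObj θ B)
sub-zeroObj θ (A ✶)   = refl

subF-cong : {θ θ′ : Sub Γ Γ′} → (∀ {A} (x : A ∈ Γ) → θ x ≡ θ′ x) →
            (φ : Fm Γ) → subF θ φ ≡ subF θ′ φ
subF-cong e (t ≐ u)  = cong₂ _≐_ (sub-cong e t) (sub-cong e u)
subF-cong e ⊥′       = refl
subF-cong e (φ ∧ ψ)  = cong₂ _∧_ (subF-cong e φ) (subF-cong e ψ)
subF-cong e (φ ∨ ψ)  = cong₂ _∨_ (subF-cong e φ) (subF-cong e ψ)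
subF-cong e (φ ⊃ ψ)  = cong₂ _⊃_ (subF-cong e φ) (subF-cong e ψ)
subF-cong e (∀′ A φ) = cong (∀′ A) (subF-cong (λ { (here refl) → refl ; (there x) → cong wk (e x) }) φ)
subF-cong e (∃′ A φ) = cong (∃′ A) (subF-cong (λ { (here refl) → refl ; (there x) → cong wk (e x) }) φ)

renF-as-subF : (ρ : Γ ⊆ Γ′) (φ : Fm Γ) → renF ρ φ ≡ subF (var ∘ ρ) φ
renF-as-subF ρ (t ≐ u)  = cong₂ _≐_ (ren-as-sub ρ t) (ren-as-sub ρ u)
renF-as-subF ρ ⊥′       = refl
renF-as-subF ρ (φ ∧ ψ)  = cong₂ _∧_ (renF-as-subF ρ φ) (renF-as-subF ρ ψ)
renF-as-subF ρ (φ ∨ ψ)  = cong₂ _∨_ (renF-as-subF ρ φ) (renF-as-subF ρ ψ)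
renF-as-subF ρ (φ ⊃ ψ)  = cong₂ _⊃_ (renF-as-subF ρ φ) (renF-as-subF ρ ψ)
renF-as-subF ρ (∀′ A φ) = cong (∀′ A) (trans (renF-as-subF (liftRen ρ) φ)
  (subF-cong (λ { (here refl) → refl ; (there x) → refl }) φ))
renF-as-subF ρ (∃′ A φ) = cong (∃′ A) (trans (renF-as-subF (liftRen ρ) φ)
  (subF-cong (λ { (here refl) → refl ; (there x) → refl }) φ))

subF-subF : (η : Sub Γ′ Γ″) (θ : Sub Γ Γ′) (φ : Fm Γ) → subF η (subF θ φ) ≡ subF (sub η ∘ θ) φ
subF-subF η θ (t ≐ u)  = cong₂ _≐_ (sub-sub η θ t) (sub-sub η θ u)
subF-subF η θ ⊥′       = refl
subF-subF η θ (φ ∧ ψ)  = cong₂ _∧_ (subF-subF η θ φ) (subF-subF η θ ψ)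
subF-subF η θ (φ ∨ ψ)  = cong₂ _∨_ (subF-subF η θ φ) (subF-subF η θ ψ)
subF-subF η θ (φ ⊃ ψ)  = cong₂ _⊃_ (subF-subF η θ φ) (subF-subF η θ ψ)
subF-subF η θ (∀′ A φ) = cong (∀′ A) (trans (subF-subF (liftSub η) (liftSub θ) φ)
  (subF-cong (λ { (here refl) → refl ; (there x) → sub-wk η (θ x) }) φ))
subF-subF η θ (∃′ A φ) = cong (∃′ A) (trans (subF-subF (liftSub η) (liftSub θ) φ)
  (subF-cong (λ { (here refl) → refl ; (there x) → sub-wk η (θ x) }) φ))

-- The commutation laws that derivations need reduce through this to a check on variables.
subF-swap : ∀ {Γ₁ Γ₂} {η : Sub Γ₁ Γ″} {θ : Sub Γ Γ₁} {η′ : Sub Γ₂ Γ″} {θ′ : Sub Γ Γ₂} →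
            (∀ {A} (x : A ∈ Γ) → sub η (θ x) ≡ sub η′ (θ′ x)) →
            (φ : Fm Γ) → subF η (subF θ φ) ≡ subF η′ (subF θ′ φ)
subF-swap {η = η} {θ} {η′} {θ′} e φ =
  trans (subF-subF η θ φ) (trans (subF-cong e φ) (sym (subF-subF η′ θ′ φ)))

subF-wkF : (θ : Sub Γ Γ′) (φ : Fm Γ) → subF (liftSub {A = B} θ) (wkF φ) ≡ wkF (subF θ φ)
subF-wkF θ φ = trans (cong (subF (liftSub θ)) (renF-as-subF there φ))
  (trans (subF-swap (λ x → ren-as-sub there (θ x)) φ) (sym (renF-as-subF there (subF θ φ))))

subF-[] : (θ : Sub Γ Γ′) (φ : Fm (B ∷ Γ)) (u : Tm Γ B) →
          subF θ (φ [ u ]ᶠ) ≡ subF (liftSub θ) φ [ sub θ u ]ᶠ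
subF-[] θ φ u = subF-swap
  (λ { (here refl) → refl ; (there x) → sym (single-wk (sub θ u) (θ x)) }) φ

-- Derivations

⊢-subst : {Δ : List (Fm Γ)} {φ ψ : Fm Γ} → φ ≡ ψ → Δ ⊢ φ → Δ ⊢ ψ
⊢-subst refl d = d

_⊆[_]_ : List (Fm Γ) → Sub Γ Γ′ → List (Fm Γ′) → Set
Δ ⊆[ θ ] Δ′ = ∀ {φ} → φ ∈ Δ → subF θ φ ∈ Δ′

⊆-∷ : {θ : Sub Γ Γ′} {Δ : List (Fm Γ)} {Δ′ : List (Fm Γ′)} {φ : Fm Γ} →
      Δ ⊆[ θ ] Δ′ → (φ ∷ Δ) ⊆[ θ ] (subF θ φ ∷ Δ′)
⊆-∷ i (here refl) = here refl
⊆-∷ i (there x)   = there (i x)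

⊆-wk : {θ : Sub Γ Γ′} {Δ : List (Fm Γ)} {Δ′ : List (Fm Γ′)} →
       Δ ⊆[ θ ] Δ′ → map (wkF {A = B}) Δ ⊆[ liftSub θ ] map wkF Δ′
⊆-wk {θ = θ} i x with ∈-map⁻ wkF x
... | φ , y , refl = subst (_∈ _) (sym (subF-wkF θ φ)) (∈-map⁺ wkF (i y))

-- Transports occur only in rules that mention a substitution, a weakening or `zeroObj`.
sub-⊢ : {Δ : List (Fm Γ)} {Δ′ : List (Fm Γ′)} {φ : Fm Γ} (θ : Sub Γ Γ′) →
        Δ ⊆[ θ ] Δ′ → Δ ⊢ φ → Δ′ ⊢ subF θ φ
sub-⊢ θ i (hyp x)     = hyp (i x)
sub-⊢ θ i (⊥E d)      = ⊥E (sub-⊢ θ i d)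
sub-⊢ θ i (∧I d e)    = ∧I (sub-⊢ θ i d) (sub-⊢ θ i e)
sub-⊢ θ i (∧E₁ d)     = ∧E₁ (sub-⊢ θ i d)
sub-⊢ θ i (∧E₂ d)     = ∧E₂ (sub-⊢ θ i d)
sub-⊢ θ i (∨I₁ d)     = ∨I₁ (sub-⊢ θ i d)
sub-⊢ θ i (∨I₂ d)     = ∨I₂ (sub-⊢ θ i d)
sub-⊢ θ i (∨E d e f)  = ∨E (sub-⊢ θ i d) (sub-⊢ θ (⊆-∷ i) e) (sub-⊢ θ (⊆-∷ i) f)
sub-⊢ θ i (⊃I d)      = ⊃I (sub-⊢ θ (⊆-∷ i) d)
sub-⊢ θ i (⊃E d e)    = ⊃E (sub-⊢ θ i d) (sub-⊢ θ i e)
sub-⊢ θ i (∀I d)      = ∀I (sub-⊢ (liftSub θ) (⊆-wk i) d)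
sub-⊢ θ i (∀E {φ = φ} d t) = ⊢-subst (sym (subF-[] θ φ t)) (∀E (sub-⊢ θ i d) (sub θ t))
sub-⊢ θ i (∃I {φ = φ} t d) = ∃I (sub θ t) (⊢-subst (subF-[] θ φ t) (sub-⊢ θ i d))
sub-⊢ θ i (∃E {ψ = ψ} d e) = ∃E (sub-⊢ θ i d)
  (⊢-subst (subF-wkF θ ψ) (sub-⊢ (liftSub θ) (⊆-∷ (⊆-wk i)) e))
sub-⊢ θ i ≐refl       = ≐refl
sub-⊢ θ i (≐subst {t = t} {u} φ d e) = ⊢-subst (sym (subF-[] θ φ u))
  (≐subst (subF (liftSub θ) φ) (sub-⊢ θ i d) (⊢-subst (subF-[] θ φ t) (sub-⊢ θ i e)))
sub-⊢ θ i (≐ext {t = t} {u} d) = ≐ext (⊢-subst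
  (cong (∀′ _) (cong₂ _≐_ (cong (_· v₀) (sub-wk θ t)) (cong (_· v₀) (sub-wk θ u))))
  (sub-⊢ θ i d))
sub-⊢ θ i (β {t = t} {u}) = ⊢-subst (cong (lam (sub (liftSub θ) t) · sub θ u ≐_) (sym (sub-[] θ t u))) β
sub-⊢ θ i rec-zero    = rec-zero
sub-⊢ θ i rec-suc     = rec-suc
sub-⊢ θ i suc≢zero    = suc≢zero
sub-⊢ θ i suc-inj     = suc-inj
sub-⊢ θ i (nat-ind φ d e) = nat-ind (subF (liftSub θ) φ) (⊢-subst (subF-[] θ φ _) (sub-⊢ θ i d))
  (⊢-subst (cong (∀′ nat) (cong (subF (liftSub θ) φ ⊃_) (subF-swap commute φ))) (sub-⊢ θ i e))
  where
  commute : ∀ {A} (x : A ∈ _) → sub (liftSub θ) (sucSub x) ≡ sub sucSub (liftSub θ x)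
  commute (here refl) = refl
  commute (there x)   = trans (ren-as-sub there (θ x)) (sym (sub-ren sucSub there (θ x)))
sub-⊢ θ i fst-pair    = fst-pair
sub-⊢ θ i snd-pair    = snd-pair
sub-⊢ θ i pair-η      = pair-η
sub-⊢ θ i len-nil     = len-nil
sub-⊢ θ i len-snoc    = len-snoc
sub-⊢ θ i (hat-nil {A} {n}) = ⊢-subst (cong (con nil ^ · sub θ n ≐_) (sym (sub-zeroObj θ A))) hat-nil
sub-⊢ θ i hat-last    = hat-last
sub-⊢ θ i hat-init    = hat-init
sub-⊢ θ i (seq-ind {A} φ d e) = seq-ind (subF (liftSub θ) φ) (⊢-subst (subF-[] θ φ _) (sub-⊢ θ i d))
  (⊢-subst (cong (∀′ (A ✶)) (cong (∀′ A) (cong₂ _⊃_ (subF-wkF (liftSub θ) φ) (subF-swap commute φ))))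
    (sub-⊢ θ i e))
  where
  commute : ∀ {B} (x : B ∈ _) → sub (liftSub (liftSub θ)) (snocSub x) ≡ sub snocSub (liftSub θ x)
  commute (here refl) = refl
  commute (there x)   = trans (ren-ren there there (θ x))
    (trans (ren-as-sub _ (θ x)) (sym (sub-ren snocSub there (θ x))))

wk-⊢ : {Δ : List (Fm Γ)} {Δ′ : List (Fm (B ∷ Γ))} {φ : Fm Γ} →
       map wkF Δ ⊆ Δ′ → Δ ⊢ φ → Δ′ ⊢ wkF φ
wk-⊢ {Δ′ = Δ′} {φ} i d = ⊢-subst (sym (renF-as-subF there φ))
  (sub-⊢ (var ∘ there) (λ {ψ} x → subst (_∈ Δ′) (renF-as-subF there ψ) (i (∈-map⁺ wkF x))) d)

-- `sub-⊢` requires the substituted hypotheses to be hypotheses again; here it is enough that they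
-- are derivable. Each is moved into the formula as an antecedent and cut after the substitution.
inst : (θ : Sub Γ Γ′) (Δ : List (Fm Γ)) {Δ′ : List (Fm Γ′)} (φ : Fm Γ) →
       Δ ⊢ φ → All (λ ψ → Δ′ ⊢ subF θ ψ) Δ → Δ′ ⊢ subF θ φ
inst θ []      φ d []       = sub-⊢ θ (λ ()) d
inst θ (ψ ∷ Δ) φ d (e ∷ es) = ⊃E (inst θ Δ (ψ ⊃ φ) (⊃I d) es) e

∅ : Sub [] Γ
∅ ()

infixl 5 _▸_
_▸_ : Sub Γ Γ′ → Tm Γ′ A → Sub (A ∷ Γ) Γ′
(θ ▸ u) (here refl) = u
(θ ▸ u) (there x)   = θ x

-- Equational reasoning inside HAω.

≐-≡ : {t t′ u u′ : Tm Γ A} → t ≡ t′ → u ≡ u′ → Δ ⊢ t ≐ u → Δ ⊢ t′ ≐ u′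
≐-≡ refl refl d = d

≐sym : {t u : Tm Γ A} → Δ ⊢ t ≐ u → Δ ⊢ u ≐ t
≐sym {t = t} {u} d = ≐-≡ refl (single-wk u t)
  (≐subst (v₀ ≐ wk t) d (≐-≡ refl (sym (single-wk t t)) ≐refl))

infixr 4 _⨟_
_⨟_ : {t u v : Tm Γ A} → Δ ⊢ t ≐ u → Δ ⊢ u ≐ v → Δ ⊢ t ≐ v
_⨟_ {t = t} {u} {v} d e = ≐-≡ (single-wk v t) refl
  (≐subst (wk t ≐ v₀) e (≐-≡ (sym (single-wk u t)) refl d))

·-congʳ : (f : Tm Γ (A ⇒ B)) {t u : Tm Γ A} → Δ ⊢ t ≐ u → Δ ⊢ f · t ≐ f · u
·-congʳ f {t} {u} d = ≐-≡ (single-wk u (f · t)) (cong (_· u) (single-wk u f))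
  (≐subst (wk (f · t) ≐ wk f · v₀) d
    (≐-≡ (sym (single-wk t (f · t))) (cong (_· t) (sym (single-wk t f))) ≐refl))

·-congˡ : {f g : Tm Γ (A ⇒ B)} (t : Tm Γ A) → Δ ⊢ f ≐ g → Δ ⊢ f · t ≐ g · t
·-congˡ {f = f} {g} t d = ≐-≡ (single-wk g (f · t)) (cong (g ·_) (single-wk g t))
  (≐subst (wk (f · t) ≐ v₀ · wk t) d
    (≐-≡ (sym (single-wk f (f · t))) (cong (f ·_) (sym (single-wk f t))) ≐refl))

·-cong : {f g : Tm Γ (A ⇒ B)} {t u : Tm Γ A} → Δ ⊢ f ≐ g → Δ ⊢ t ≐ u → Δ ⊢ f · t ≐ g · u
·-cong d e = ·-congˡ _ d ⨟ ·-congʳ _ e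

lam-cong : {t u : Tm (A ∷ Γ) B} → map wkF Δ ⊢ t ≐ u → Δ ⊢ lam t ≐ lam u
lam-cong {t = t} {u} d = ≐ext (∀I
  (≐-≡ refl (wk-[v₀] t) β ⨟ d ⨟ ≐sym (≐-≡ refl (wk-[v₀] u) β)))

wk-lam-β : {t : Tm (A ∷ Γ) B} → Δ ⊢ wk (lam t) · v₀ ≐ t
wk-lam-β {t = t} = ≐-≡ refl (wk-[v₀] t) β

wk²-as-sub : (t : Tm Γ A) → sub (var ∘ there ∘ there) t ≡ wk {B = B} (wk {B = η} t)
wk²-as-sub t = sym (trans (ren-ren there there t) (ren-as-sub _ t))

-- The two weakenings are for the two variables, a term and its translation, that the logical
-- relation introduces at a function type.
wk²-lam-β : {C D : Ty} {Δ : List (Fm (C ∷ D ∷ Γ′))} (θ : Sub Γ Γ′) (t : Tm (A ∷ Γ) B)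
            (u : Tm (C ∷ D ∷ Γ′) A) →
            Δ ⊢ wk (wk (sub θ (lam t))) · u ≐ sub ((λ x → wk (wk (θ x))) ▸ u) t
wk²-lam-β {Γ′ = Γ′} {Γ = Γ} {A = A} {C = C} {D} θ t u = ≐-≡ refl eq β
  where
  t′ = sub (liftSub θ) t
  π : Sub (A ∷ Γ′) (C ∷ D ∷ Γ′)
  π x = single u (liftRen there (liftRen there x))

  commute : ∀ {B} (x : B ∈ A ∷ Γ) → sub π (liftSub θ x) ≡ ((λ y → wk (wk (θ y))) ▸ u) x
  commute (here refl) = refl
  commute (there x)   = trans (sub-ren π there (θ x)) (wk²-as-sub (θ x))

  eq : ren (liftRen there) (ren (liftRen there) t′) [ u ]ᵗ ≡ sub ((λ x → wk (wk (θ x))) ▸ u) t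
  eq = trans (sub-ren (single u) (liftRen there) (ren (liftRen there) t′))
    (trans (sub-ren (single u ∘ liftRen there) (liftRen there) t′)
      (trans (sub-sub π (liftSub θ) t) (sub-cong commute t)))

-- Normalisation

-- The derivation is uniform in the hypotheses, because `lam-cong` treats the body of a λ under
-- weakened ones.
Reduct : Tm Γ A → Set
Reduct {Γ} t = Σ (Tm Γ _) λ u → ∀ {Δ} → Δ ⊢ t ≐ u

contract : (t : Tm Γ A) → Maybe (Reduct t)
contract (lam t · u)                           = just (t [ u ]ᵗ , β)
contract (con (rec A) · a · f · con zero)      = just (a , rec-zero)
contract (con (rec A) · a · f · (con suc · n)) = just (f · n · (con (rec A) · a · f · n) , rec-suc)
contract (con fst · (con pair · a · b))        = just (a , fst-pair)
contract (con snd · (con pair · a · b))        = just (b , snd-pair)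
contract (con len · con nil)                   = just (con zero , len-nil)
contract (con len · (con snoc · s · x))        = just (con suc · (con len · s) , len-snoc)
contract _                                     = nothing

mutual
  -- Fuel replaces a termination argument. Each result carries its own derivation, so too little
  -- fuel can only leave a term less reduced.
  normalise : ℕ → (t : Tm Γ A) → Reduct t
  normalise zero    t       = t , ≐refl
  normalise (suc n) (lam t) = let t′ , d = normalise n t in lam t′ , lam-cong d
  normalise (suc n) (t · u) =
    let t′ , d = normalise n t ; u′ , e = normalise n u ; v , f = reduce n (t′ · u′)
    in v , ·-cong d e ⨟ f
  normalise (suc n) t       = t , ≐refl

  reduce : ℕ → (t : Tm Γ A) → Reduct t
  reduce n t with contract t
  ... | just (u , d) = let v , e = normalise n u in v , d ⨟ e
  ... | nothing      = t , ≐refl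

-- Since conv compares normal forms, lemmas about arbitrary terms are proved for
-- variables and then transferred by inst.
conv : {t u : Tm Γ A} → proj₁ (normalise 40 t) ≡ proj₁ (normalise 40 u) → Δ ⊢ t ≐ u
conv {t = t} {u} e = proj₂ (normalise 40 t) ⨟ ≐-≡ (sym e) refl (≐sym (proj₂ (normalise 40 u)))

-- Arithmetic

zero-or-suc : (n : Tm Γ nat) → Δ ⊢ n ≐ con zero ∨ ∃′ nat (wk n ≐ con suc · v₀)
zero-or-suc n = inst (∅ ▸ n) [] (v₀ ≐ con zero ∨ ∃′ nat (v₁ ≐ con suc · v₀))
  (∀E (nat-ind (v₀ ≐ con zero ∨ ∃′ nat (v₁ ≐ con suc · v₀))
    (∨I₁ ≐refl) (∀I (⊃I (∨I₂ (∃I v₀ ≐refl))))) v₀) []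

0+n : (n : Tm Γ nat) → Δ ⊢ plus · con zero · n ≐ n
0+n n = inst (∅ ▸ n) [] (plus · con zero · v₀ ≐ v₀)
  (∀E (nat-ind (plus · con zero · v₀ ≐ v₀) (conv refl)
    (∀I (⊃I (conv refl ⨟ ·-congʳ (con suc) h₀)))) v₀) []

suc+n : (m n : Tm Γ nat) → Δ ⊢ plus · (con suc · m) · n ≐ con suc · (plus · m · n)
suc+n m n = inst (∅ ▸ m ▸ n) [] (plus · (con suc · v₁) · v₀ ≐ con suc · (plus · v₁ · v₀))
  (∀E (nat-ind (plus · (con suc · v₂) · v₀ ≐ con suc · (plus · v₂ · v₀)) (conv refl)
    (∀I (⊃I (conv refl ⨟ ·-congʳ (con suc) h₀ ⨟ conv refl)))) v₀) []

-- `monus` peels off one `pred` per step of its second argument, so the induction on `l` keeps `m`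
-- general and uses its hypothesis at the successor of `m`.
1+l+m∸l : (l m : Tm Γ nat) → Δ ⊢ ltTest (plus · l · m) l ≐ con suc · m
1+l+m∸l l m = inst (∅ ▸ l ▸ m) [] (ltTest (plus · v₁ · v₀) v₁ ≐ con suc · v₀)
  (∀E (∀E (nat-ind (∀′ nat (ltTest (plus · v₁ · v₀) v₁ ≐ con suc · v₀))
    (∀I (conv refl ⨟ ·-congʳ (con suc) (0+n v₀)))
    (∀I (⊃I (∀I (·-congˡ _ (·-congʳ monus (·-congʳ (con suc) (suc+n v₁ v₀)))
      ⨟ conv refl
      ⨟ ·-congʳ pred (∀E h₀ (con suc · v₀))
      ⨟ conv refl))))) v₁) v₀) []

n∸n+1+k : (n k : Tm Γ nat) → Δ ⊢ ltTest n (plus · (con suc · n) · k) ≐ con zero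
n∸n+1+k n k = inst (∅ ▸ n ▸ k) [] (ltTest v₁ (plus · (con suc · v₁) · v₀) ≐ con zero)
  (∀E (nat-ind (ltTest v₂ (plus · (con suc · v₂) · v₀) ≐ con zero)
    -- For `k` zero the term is `pred` of suc n ∸ n, which the previous lemma evaluates to one.
    (conv refl ⨟ ·-congʳ pred (1+l+m∸l v₁ (con zero)) ⨟ conv refl)
    (∀I (⊃I (conv refl ⨟ ·-congʳ pred h₀ ⨟ conv refl)))) v₀) []

-- The equational form of n < l, on which `ifZero` branches in `Ψ` and `𝓗`.
LT : Tm Γ nat → Tm Γ nat → Fm Γ
LT n l = ltTest n l ≐ con zero

≺⇒LT : (n l : Tm Γ nat) → Δ ⊢ n ≺ l → Δ ⊢ LT n l
≺⇒LT n l d = inst (∅ ▸ n ▸ l) [ v₁ ≺ v₀ ] (LT v₁ v₀)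
  (∃E h₀ (·-congʳ (monus · (con suc · v₂)) (≐sym h₀) ⨟ n∸n+1+k v₂ v₀)) (d ∷ [])

-- The witness is the excess of `n` over `l`. A successor value sends `ifZero` to its second branch
-- and lets `φ-term` take a step.
≽⇒ltTest-suc : (n l : Tm Γ nat) → Δ ⊢ n ≽ l → Δ ⊢ ∃′ nat (ltTest (wk n) (wk l) ≐ con suc · v₀)
≽⇒ltTest-suc n l d = inst (∅ ▸ n ▸ l) [ v₁ ≽ v₀ ] (∃′ nat (ltTest v₂ v₁ ≐ con suc · v₀))
  (∃E h₀ (∃I v₀ (·-congˡ v₁ (·-congʳ monus (·-congʳ (con suc) (≐sym h₀))) ⨟ 1+l+m∸l v₁ v₀)))
  (d ∷ [])

-- Types of the recursors in a term

recTypesᶜ : Con A → List Ty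
recTypesᶜ (rec A) = [ A ]
recTypesᶜ _       = []

recTypes : Tm Γ A → List Ty
recTypes (var x) = []
recTypes (lam t) = recTypes t
recTypes (t · u) = recTypes t ++ recTypes u
recTypes (con c) = recTypesᶜ c

-- For a fixed term the list computes, so membership in a fragment comes down to one inequality per
-- recursor.
∈T-recTypes : ∀ {i} (t : Tm Γ A) → All (λ B → level B ≤ i) (recTypes t) → t ∈T i
∈T-recTypes (var x) l = tt
∈T-recTypes (lam t) l = ∈T-recTypes t l
∈T-recTypes (t · u) l = ∈T-recTypes t (++⁻ˡ (recTypes t) l) , ∈T-recTypes u (++⁻ʳ (recTypes t) l)
∈T-recTypes (con (rec A)) (l ∷ []) = l
∈T-recTypes (con zero) l = tt
∈T-recTypes (con suc) l = tt
∈T-recTypes (con pair) l = tt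
∈T-recTypes (con fst) l = tt
∈T-recTypes (con snd) l = tt
∈T-recTypes (con nil) l = tt
∈T-recTypes (con snoc) l = tt
∈T-recTypes (con len) l = tt
∈T-recTypes (con hat) l = tt

ren-∈T : ∀ {i j} → i ≤ j → (ρ : Γ ⊆ Γ′) (t : Tm Γ A) → t ∈T i → ren ρ t ∈T j
ren-∈T i≤j ρ (var x) l = tt
ren-∈T i≤j ρ (lam t) l = ren-∈T i≤j (liftRen ρ) t l
ren-∈T i≤j ρ (t · u) (l , m) = ren-∈T i≤j ρ t l , ren-∈T i≤j ρ u m
ren-∈T i≤j ρ (con (rec A)) l = ≤-trans l i≤j
ren-∈T i≤j ρ (con zero) l = tt
ren-∈T i≤j ρ (con suc) l = tt
ren-∈T i≤j ρ (con pair) l = tt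
ren-∈T i≤j ρ (con fst) l = tt
ren-∈T i≤j ρ (con snd) l = tt
ren-∈T i≤j ρ (con nil) l = tt
ren-∈T i≤j ρ (con snoc) l = tt
ren-∈T i≤j ρ (con len) l = tt
ren-∈T i≤j ρ (con hat) l = tt

module _ (σ : Ty) where
  open Translation σ

  -- Finite sequences and their extensions

  Agree : Tm Γ (nat ✶) → Tm Γ (nat ⇒ nat) → Fm Γ
  Agree s b = ∀′ nat (LT v₀ ∣ wk s ∣ ⊃ wk b · v₀ ≐ wk s ^ · v₀)

  -- The first conjunct is |s| ≤ |s′|, in the form in which `Ext-LT` consumes it.
  Ext : Tm Γ (nat ✶) → Tm Γ (nat ✶) → Fm Γ
  Ext s s′ = ∀′ nat (LT v₀ ∣ wk s ∣ ⊃ LT v₀ ∣ wk s′ ∣) ∧ Agree s (s′ ^)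

  Constant : Tm Γ ((nat ⇒ nat) ⇒ nat) → Tm Γ (nat ✶) → Fm Γ
  Constant Y s = ∀′ (nat ⇒ nat) (Agree (wk s) v₀ ⊃ wk Y · v₀ ≐ wk Y · wk s ^)

  Agree-elim : (s : Tm Γ (nat ✶)) (b : Tm Γ (nat ⇒ nat)) (n : Tm Γ nat) →
               Δ ⊢ Agree s b → Δ ⊢ LT n ∣ s ∣ → Δ ⊢ b · n ≐ s ^ · n
  Agree-elim s b n d e = inst (∅ ▸ s ▸ b ▸ n) (Agree v₂ v₁ ∷ LT v₀ ∣ v₂ ∣ ∷ [])
    (v₁ · v₀ ≐ v₂ ^ · v₀) (⊃E (∀E h₀ v₀) h₁) (d ∷ e ∷ [])

  Ext-LT : (s s′ : Tm Γ (nat ✶)) (n : Tm Γ nat) →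
           Δ ⊢ Ext s s′ → Δ ⊢ LT n ∣ s ∣ → Δ ⊢ LT n ∣ s′ ∣
  Ext-LT s s′ n d e = inst (∅ ▸ s ▸ s′ ▸ n) (Ext v₂ v₁ ∷ LT v₀ ∣ v₂ ∣ ∷ [])
    (LT v₀ ∣ v₁ ∣) (⊃E (∀E (∧E₁ h₀) v₀) h₁) (d ∷ e ∷ [])

  Constant-elim : (Y : Tm Γ ((nat ⇒ nat) ⇒ nat)) (s : Tm Γ (nat ✶)) (b : Tm Γ (nat ⇒ nat)) →
                  Δ ⊢ Constant Y s → Δ ⊢ Agree s b → Δ ⊢ Y · b ≐ Y · s ^
  Constant-elim Y s b d e = inst (∅ ▸ Y ▸ s ▸ b) (Constant v₂ v₁ ∷ Agree v₁ v₀ ∷ [])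
    (v₂ · v₀ ≐ v₂ · v₁ ^) (⊃E (∀E h₀ v₀) h₁) (d ∷ e ∷ [])

  Ext-refl : (s : Tm Γ (nat ✶)) → Δ ⊢ Ext s s
  Ext-refl s = inst (∅ ▸ s) [] (Ext v₀ v₀) (∧I (∀I (⊃I h₀)) (∀I (⊃I ≐refl))) []

  Ext-snoc : (s : Tm Γ (nat ✶)) (x : Tm Γ nat) → Δ ⊢ Ext s (s ∗ x)
  Ext-snoc s x = inst (∅ ▸ s ▸ x) [] (Ext v₁ (v₁ ∗ v₀)) (∧I
    (∀I (⊃I (conv refl ⨟ ·-congʳ pred h₀ ⨟ conv refl)))
    -- A position n below |s| is not |s| itself: n = |s| would give 1 = suc n ∸ n = 0.
    (∀I (⊃I (⊃E hat-init (⊃I (⊃E suc≢zero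
      (≐sym (1+l+m∸l v₀ (con zero)) ⨟ conv refl ⨟ ·-congʳ (monus · (con suc · v₀)) h₀ ⨟ h₁))))))) []

  -- Ψ

  -- The number suc k ∸ |s| is both the test and the recursion count, and φ at 0 is G; a case
  -- analysis on this number unifies the two branches.
  Ψ-as-φ : (k : Tm Γ nat) (G : Tm Γ 𝔾) (H : Tm Γ ℍ) (s : Tm Γ (nat ✶)) →
           Δ ⊢ Ψ · k · G · H · s ≐ φ-term · G · H · ltTest k ∣ s ∣ · s
  Ψ-as-φ k G H s = inst (∅ ▸ k ▸ G ▸ H ▸ s) []
    (Ψ · v₃ · v₂ · v₁ · v₀ ≐ φ-term · v₂ · v₁ · ltTest v₃ ∣ v₀ ∣ · v₀)
    (conv refl ⨟ ∀E (nat-ind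
      (ifZero · v₀ · (v₃ · v₁) · (φ-term · v₃ · v₂ · v₀ · v₁) ≐ φ-term · v₃ · v₂ · v₀ · v₁)
      (conv refl) (∀I (⊃I (conv refl)))) (ltTest v₃ ∣ v₀ ∣)) []

  Ψ-stop : (k : Tm Γ nat) (G : Tm Γ 𝔾) (H : Tm Γ ℍ) (s : Tm Γ (nat ✶)) →
           Δ ⊢ LT k ∣ s ∣ → Δ ⊢ Ψ · k · G · H · s ≐ G · s
  Ψ-stop k G H s d =
    inst (∅ ▸ k ▸ G ▸ H ▸ s) [ LT v₃ ∣ v₀ ∣ ] (Ψ · v₃ · v₂ · v₁ · v₀ ≐ v₂ · v₀)
    (Ψ-as-φ v₃ v₂ v₁ v₀ ⨟ ·-congˡ v₀ (·-congʳ (φ-term · v₂ · v₁) h₀) ⨟ conv refl) (d ∷ [])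

  Ψ-step : (k m : Tm Γ nat) (G : Tm Γ 𝔾) (H : Tm Γ ℍ) (s : Tm Γ (nat ✶)) →
           Δ ⊢ ltTest k ∣ s ∣ ≐ con suc · m →
           Δ ⊢ Ψ · k · G · H · s ≐ H · s · lam (Ψ · wk k · wk G · wk H · (wk s ∗ v₀))
  Ψ-step k m G H s d = inst (∅ ▸ m ▸ k ▸ G ▸ H ▸ s)
    [ ltTest v₃ ∣ v₀ ∣ ≐ con suc · v₄ ]
    (Ψ · v₃ · v₂ · v₁ · v₀ ≐ v₁ · v₀ · lam (Ψ · v₄ · v₃ · v₂ · (v₁ ∗ v₀)))
    (Ψ-as-φ v₃ v₂ v₁ v₀
      ⨟ ·-congˡ v₀ (·-congʳ (φ-term · v₂ · v₁) h₀)
      ⨟ conv {u = v₁ · v₀ · lam (φ-term · v₃ · v₂ · v₅ · (v₁ ∗ v₀))} refl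
      ⨟ ·-congʳ (v₁ · v₀) (lam-cong (
          ·-congˡ (v₁ ∗ v₀) (·-congʳ (φ-term · v₃ · v₂) (
            -- The count left for s * x is one less than that for s: `m` is rewritten as `pred` of
            -- suc k ∸ |s|, which is suc k ∸ |s * x|.
            conv {u = pred · (con suc · v₅)} refl ⨟ ·-congʳ pred (≐sym h₀) ⨟ conv refl))
          ⨟ ≐sym (Ψ-as-φ v₄ v₃ v₂ (v₁ ∗ v₀)))))
    (d ∷ [])

  -- Good functionals

  Stop Step : Tm Γ (nat °) → Tm Γ 𝔾 → Tm Γ ℍ → Tm Γ (nat ✶) → Fm Γ
  Stop u G H s = Constant (Val u) s
    ∧ ∀′ (nat ✶) (Ext (wk s) v₀ ⊃ 𝖡 (wk u) · wk G · wk H · v₀ ≐ wk G · v₀)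
  Step u G H s = 𝖡 u · G · H · s ≐ H · s · lam (𝖡 (wk u) · wk G · wk H · (wk s ∗ v₀))

  Good : Tm Γ (nat °) → Fm Γ
  Good u = ∀′ 𝔾 (∀′ ℍ (∀′ (nat ✶)
    (Stop (wk (wk (wk u))) v₂ v₁ v₀ ∨ Step (wk (wk (wk u))) v₂ v₁ v₀)))

  Good-elim : (u : Tm Γ (nat °)) (G : Tm Γ 𝔾) (H : Tm Γ ℍ) (s : Tm Γ (nat ✶)) →
              Δ ⊢ Good u → Δ ⊢ Stop u G H s ∨ Step u G H s
  Good-elim u G H s d = inst (∅ ▸ u ▸ G ▸ H ▸ s) [ Good v₃ ]
    (Stop v₃ v₂ v₁ v₀ ∨ Step v₃ v₂ v₁ v₀) (∀E (∀E (∀E h₀ v₂) v₁) v₀) (d ∷ [])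

  Stop-elim : (u : Tm Γ (nat °)) (G : Tm Γ 𝔾) (H : Tm Γ ℍ) (s s′ : Tm Γ (nat ✶)) →
              Δ ⊢ Stop u G H s → Δ ⊢ Ext s s′ → Δ ⊢ 𝖡 u · G · H · s′ ≐ G · s′
  Stop-elim u G H s s′ d e = inst (∅ ▸ u ▸ G ▸ H ▸ s ▸ s′) (Stop v₄ v₃ v₂ v₁ ∷ Ext v₁ v₀ ∷ [])
    (𝖡 v₄ · v₃ · v₂ · v₀ ≐ v₃ · v₀) (⊃E (∀E (∧E₂ h₀) v₀) h₁) (d ∷ e ∷ [])

  -- G⁺ plays the role of λ s′. Ψ (Val u ŝ′) G H s′.  It is kept abstract because
  -- wk does not compute on a λ-term whose body mentions an unknown u.
  IsΨ : Tm Γ (nat °) → Tm Γ 𝔾 → Tm Γ 𝔾 → Tm Γ ℍ → Fm Γ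
  IsΨ u G⁺ G H = ∀′ (nat ✶) (wk G⁺ · v₀ ≐ Ψ · (Val (wk u) · v₀ ^) · wk G · wk H · v₀)

  -- Beyond s the bound Val u ŝ′ is frozen at Val u ŝ. `H⁺` is kept apart from `H` because bar
  -- recursion supplies `𝓗` there.
  Stop⇒Ψ : (u : Tm Γ (nat °)) (G⁺ G : Tm Γ 𝔾) (H H⁺ : Tm Γ ℍ) (s s′ : Tm Γ (nat ✶)) →
           Δ ⊢ IsΨ u G⁺ G H → Δ ⊢ Stop u G⁺ H⁺ s → Δ ⊢ Ext s s′ →
           Δ ⊢ 𝖡 u · G⁺ · H⁺ · s′ ≐ Ψ · (Val u · s ^) · G · H · s′
  Stop⇒Ψ u G⁺ G H H⁺ s s′ c d e = inst (∅ ▸ u ▸ G⁺ ▸ G ▸ H ▸ H⁺ ▸ s ▸ s′)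
    (IsΨ v₆ v₅ v₄ v₃ ∷ Stop v₆ v₅ v₂ v₁ ∷ Ext v₁ v₀ ∷ [])
    (𝖡 v₆ · v₅ · v₂ · v₀ ≐ Ψ · (Val v₆ · v₁ ^) · v₄ · v₃ · v₀)
    (Stop-elim v₆ v₅ v₂ v₁ v₀ h₁ h₂
      ⨟ ∀E h₀ v₀
      ⨟ ·-congˡ v₀ (·-congˡ v₃ (·-congˡ v₄ (·-congʳ Ψ
          (Constant-elim (Val v₆) v₁ (v₀ ^) (∧E₁ h₁) (∧E₂ h₂))))))
    (c ∷ d ∷ e ∷ [])

  Stop⇒Ψ-step : (u : Tm Γ (nat °)) (m : Tm Γ nat) (G⁺ G : Tm Γ 𝔾) (H H⁺ : Tm Γ ℍ)
                (s : Tm Γ (nat ✶)) →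
                Δ ⊢ IsΨ u G⁺ G H → Δ ⊢ Stop u G⁺ H⁺ s →
                Δ ⊢ ltTest (Val u · s ^) ∣ s ∣ ≐ con suc · m →
                Δ ⊢ 𝖡 u · G⁺ · H⁺ · s ≐ H · s · lam (𝖡 (wk u) · wk G⁺ · wk H⁺ · (wk s ∗ v₀))
  Stop⇒Ψ-step u m G⁺ G H H⁺ s c d e = inst (∅ ▸ m ▸ u ▸ G⁺ ▸ G ▸ H ▸ H⁺ ▸ s)
    (IsΨ v₅ v₄ v₃ v₂ ∷ Stop v₅ v₄ v₁ v₀ ∷ ltTest (Val v₅ · v₀ ^) ∣ v₀ ∣ ≐ con suc · v₆ ∷ [])
    (𝖡 v₅ · v₄ · v₁ · v₀ ≐ v₂ · v₀ · lam (𝖡 v₆ · v₅ · v₂ · (v₁ ∗ v₀)))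
    (Stop⇒Ψ v₅ v₄ v₃ v₂ v₁ v₀ v₀ h₀ h₁ (Ext-refl v₀)
      ⨟ Ψ-step (Val v₅ · v₀ ^) v₆ v₃ v₂ v₀ h₂
      ⨟ ·-congʳ (v₂ · v₀) (lam-cong
          (≐sym (Stop⇒Ψ v₆ v₅ v₄ v₃ v₂ v₁ (v₁ ∗ v₀) h₀ h₁ (Ext-snoc v₁ v₀)))))
    (c ∷ d ∷ e ∷ [])

  -- The first alternative always holds: the value is constant and `𝖡` returns G.
  Good-num : [] ⊢ Good {Γ = nat ∷ []} (numᵒ · v₀)
  Good-num = ∀I (∀I (∀I (∨I₁ (∧I (∀I (⊃I (conv refl))) (∀I (⊃I (conv refl)))))))

  Good-zero : [] ⊢ Good {Γ = []} zeroᵒ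
  Good-zero = ∀I (∀I (∀I (∨I₁ (∧I (∀I (⊃I (conv refl))) (∀I (⊃I (conv refl)))))))

  Good-suc : [ Good v₀ ] ⊢ Good {Γ = nat ° ∷ []} (sucᵒ · v₀)
  Good-suc = ∀I (∀I (∀I (∨E (Good-elim v₃ v₂ v₁ v₀ h₀)
    (∨I₁ (∧I
      (∀I (⊃I (conv refl ⨟ ·-congʳ (con suc) (Constant-elim (Val v₄) v₁ v₀ (∧E₁ h₁) h₀) ⨟ conv refl)))
      (∀I (⊃I (conv refl ⨟ Stop-elim v₄ v₃ v₂ v₁ v₀ h₁ h₀)))))
    (∨I₂ (conv refl ⨟ h₀ ⨟ conv refl)))))

  -- `𝖡` of the translation runs x with G⁺, so a step of x is a step of the whole. If x stops at s,
  -- then n = Val x ŝ is frozen: for n < |s| the value α(n) is read off s and Ψ n returns G;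
  -- otherwise Ψ n makes one step.
  Good-α : [ Good v₀ ] ⊢ Good {Γ = nat ° ∷ []} (αᵒ · v₀)
  Good-α = ∀I (∀I (∀I (∨E (Good-elim v₃ (lam (Ψ · (Val v₄ · v₀ ^) · v₃ · v₂ · v₀)) v₁ v₀ h₀)
    (∨E (zero-or-suc (ltTest (Val v₃ · v₀ ^) ∣ v₀ ∣))
      (∨I₁ (∧I
        (∀I (⊃I (conv refl
          ⨟ ·-congʳ v₀ (Constant-elim (Val v₄) v₁ v₀ (∧E₁ h₂) h₀)
          ⨟ Agree-elim v₁ v₀ (Val v₄ · v₁ ^) h₀ h₁
          ⨟ conv refl)))
        (∀I (⊃I (conv refl
          ⨟ Stop⇒Ψ v₄ _ v₃ v₂ v₂ v₁ v₀ (∀I (conv refl)) h₂ h₀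
          ⨟ Ψ-stop (Val v₄ · v₁ ^) v₃ v₂ v₀ (Ext-LT v₁ v₀ (Val v₄ · v₁ ^) h₀ h₁))))))
      (∃E h₀ (∨I₂ (conv refl ⨟ Stop⇒Ψ-step v₄ v₀ _ v₃ v₂ v₂ v₁ (∀I (conv refl)) h₂ h₀ ⨟ conv refl))))
    (∨I₂ (conv refl ⨟ h₀ ⨟ conv refl)))))

  -- The counterpart of `IsΨ` for the functional that the translated recursor passes to `𝖡 x`.
  IsComp : Tm Γ (nat °) → Tm Γ (nat ⇒ nat °) → Tm Γ 𝔾 → Tm Γ 𝔾 → Tm Γ ℍ → Fm Γ
  IsComp x r G⁺ G H = ∀′ (nat ✶) (wk G⁺ · v₀ ≐ 𝖡 (wk r · (Val (wk x) · v₀ ^)) · wk G · wk H · v₀)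

  Stop⇒𝖡 : (x : Tm Γ (nat °)) (r : Tm Γ (nat ⇒ nat °)) (G⁺ G : Tm Γ 𝔾) (H : Tm Γ ℍ)
           (s s′ : Tm Γ (nat ✶)) → Δ ⊢ IsComp x r G⁺ G H → Δ ⊢ Stop x G⁺ H s → Δ ⊢ Ext s s′ →
           Δ ⊢ 𝖡 x · G⁺ · H · s′ ≐ 𝖡 (r · (Val x · s ^)) · G · H · s′
  Stop⇒𝖡 x r G⁺ G H s s′ c d e = inst (∅ ▸ x ▸ r ▸ G⁺ ▸ G ▸ H ▸ s ▸ s′)
    (IsComp v₆ v₅ v₄ v₃ v₂ ∷ Stop v₆ v₄ v₂ v₁ ∷ Ext v₁ v₀ ∷ [])
    (𝖡 v₆ · v₄ · v₂ · v₀ ≐ 𝖡 (v₅ · (Val v₆ · v₁ ^)) · v₃ · v₂ · v₀)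
    (Stop-elim v₆ v₄ v₂ v₁ v₀ h₁ h₂
      ⨟ ∀E h₀ v₀
      ⨟ ·-congˡ v₀ (·-congˡ v₂ (·-congˡ v₃ (·-congʳ (con snd) (·-congʳ v₅
          (Constant-elim (Val v₆) v₁ (v₀ ^) (∧E₁ h₁) (∧E₂ h₂)))))))
    (c ∷ d ∷ e ∷ [])

  -- If x stops at s, the stage n = Val x ŝ is fixed beyond s, and whichever alternative holds for
  -- r[n] at the same G, H and s is passed on. If x steps, so does the whole.
  Good-rec : Good v₁ ∷ ∀′ nat (Good (v₁ · v₀)) ∷ []
             ⊢ Good {Γ = (nat ⇒ nat °) ∷ nat ° ∷ []} (recBody natᵖ · v₁ · v₀)
  Good-rec = ∀I (∀I (∀I (∨E
    (Good-elim v₄ (lam (𝖡 (v₄ · (Val v₅ · v₀ ^)) · v₃ · v₂ · v₀)) v₁ v₀ h₀)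
    (∨E (Good-elim (v₃ · (Val v₄ · v₀ ^)) v₂ v₁ v₀ (∀E h₂ (Val v₄ · v₀ ^)))
      (∨I₁ (∧I
        (∀I (⊃I (conv refl
          ⨟ ·-congˡ v₀ (·-congʳ (con fst) (·-congʳ v₄ (Constant-elim (Val v₅) v₁ v₀ (∧E₁ h₂) h₀)))
          ⨟ Constant-elim (Val (v₄ · (Val v₅ · v₁ ^))) v₁ v₀ (∧E₁ h₁) h₀
          ⨟ conv refl)))
        (∀I (⊃I (conv refl
          ⨟ Stop⇒𝖡 v₅ v₄ _ v₃ v₂ v₁ v₀ (∀I (conv refl)) h₂ h₀
          ⨟ Stop-elim (v₄ · (Val v₅ · v₁ ^)) v₃ v₂ v₁ v₀ h₁ h₀)))))
      (∨I₂ (conv refl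
        ⨟ Stop⇒𝖡 v₄ v₃ _ v₂ v₁ v₀ v₀ (∀I (conv refl)) h₁ (Ext-refl v₀)
        ⨟ h₀
        -- Since s * x extends s, the stage is still the one computed at s.
        ⨟ ·-congʳ (v₁ · v₀) (lam-cong
            (≐sym (Stop⇒𝖡 v₅ v₄ _ v₃ v₂ v₁ (v₁ ∗ v₀) (∀I (conv refl)) h₁ (Ext-snoc v₁ v₀))))
        ⨟ conv refl)))
    (∨I₂ (conv refl ⨟ h₀ ⨟ conv refl)))))

  -- Spector's bar recursor

  -- 𝓗, Φ and SpectorBR for an open Y, with wk in place of closed.
  𝓗′ : Tm Γ ((nat ⇒ nat) ⇒ nat) → Tm Γ (𝔾 ⇒ ℍ ⇒ ℍ)
  𝓗′ Y = lam (lam (lam (lam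
    (ifZero · ltTest (wk (wk (wk (wk Y))) · v₁ ^) ∣ v₁ ∣ · (v₃ · v₁) · (v₂ · v₁ · v₀)))))

  Φ′ : Tm Γ ((nat ⇒ nat) ⇒ nat) → Tm Γ (𝔹 ⇒ 𝔹)
  Φ′ Y = lam (lam (lam (lam
    (v₃ · lam (Ψ · (wk (wk (wk (wk (wk Y)))) · v₀ ^) · v₃ · v₂ · v₀)
        · (𝓗′ (wk (wk (wk (wk Y)))) · v₂ · v₁)
        · v₀))))

  Spector′ : Tm Γ ((nat ⇒ nat) ⇒ nat) → Tm Γ 𝔹 → Fm Γ
  Spector′ Y ξ = ∀′ 𝔾 (∀′ ℍ (∀′ (nat ✶)
    ( (Y₃ · v₀ ^ ≺ ∣ v₀ ∣ ⊃ ξ₃ · v₂ · v₁ · v₀ ≐ v₂ · v₀)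
    ∧ (Y₃ · v₀ ^ ≽ ∣ v₀ ∣ ⊃ ξ₃ · v₂ · v₁ · v₀ ≐ v₁ · v₀ · lam (wk ξ₃ · v₃ · v₂ · (v₁ ∗ v₀))))))
    where
    Y₃ = wk (wk (wk Y))
    ξ₃ = wk (wk (wk ξ))

  -- The terms differ only in how Y reaches its occurrences, under five binders in the argument of Δ
  -- and eight inside `𝓗`; for closed Y both ways agree.
  Φ-closed : (Y : Tm [] ((nat ⇒ nat) ⇒ nat)) → Φ Y ≡ Φ′ Y
  Φ-closed Y = cong₂ (λ y₅ y₈ → lam (lam (lam (lam
    (v₃ · lam (Ψ · (y₅ · v₀ ^) · v₃ · v₂ · v₀)
        · (lam (lam (lam (lam
            (ifZero · ltTest (y₈ · v₁ ^) ∣ v₁ ∣ · (v₃ · v₁) · (v₂ · v₁ · v₀))))) · v₂ · v₁)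
        · v₀)))))
    (wk-closed (wk-closed (wk-closed (wk-closed (wk-closed (closed-[] Y))))))
    (wk-closed (wk-closed (wk-closed (wk-closed
      (wk-closed (wk-closed (wk-closed (wk-closed (closed-[] Y)))))))))
    where
    wk-closed : {t : Tm Γ A} {u : Tm [] A} → closed u ≡ t → closed u ≡ wk {B = B} t
    wk-closed {u = u} refl = sym (ren-closed there u)

  SpectorBR-closed : (Y : Tm [] ((nat ⇒ nat) ⇒ nat)) (ξ : Tm [] 𝔹) → SpectorBR Y ξ ≡ Spector′ Y ξ
  SpectorBR-closed Y ξ = trans
    (cong (F (closed Y) (closed ξ)) (closed₄ ξ))
    (cong₂ (λ y x → F y x (wk x)) (closed₃ Y) (closed₃ ξ))
    where
    F : Tm (nat ✶ ∷ ℍ ∷ 𝔾 ∷ []) ((nat ⇒ nat) ⇒ nat) → Tm (nat ✶ ∷ ℍ ∷ 𝔾 ∷ []) 𝔹 →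
        Tm (nat ∷ nat ✶ ∷ ℍ ∷ 𝔾 ∷ []) 𝔹 → Fm []
    F y x x′ = ∀′ 𝔾 (∀′ ℍ (∀′ (nat ✶)
      ( (y · v₀ ^ ≺ ∣ v₀ ∣ ⊃ x · v₂ · v₁ · v₀ ≐ v₂ · v₀)
      ∧ (y · v₀ ^ ≽ ∣ v₀ ∣ ⊃ x · v₂ · v₁ · v₀ ≐ v₁ · v₀ · lam (x′ · v₃ · v₂ · (v₁ ∗ v₀))))))
    closed₃ : ∀ {A B C D} (t : Tm [] A) → closed {Γ = B ∷ C ∷ D ∷ []} t ≡ wk (wk (wk t))
    closed₃ t = trans (sym (ren-closed there t)) (cong wk (trans (sym (ren-closed there t))
      (cong wk (trans (sym (ren-closed there t)) (cong wk (closed-[] t))))))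
    closed₄ : ∀ {A B C D E} (t : Tm [] A) → closed {Γ = B ∷ C ∷ D ∷ E ∷ []} t ≡ wk (closed t)
    closed₄ t = sym (ren-closed there t)

  𝓗-stop : (Y : Tm Γ ((nat ⇒ nat) ⇒ nat)) (G : Tm Γ 𝔾) (H : Tm Γ ℍ) (s : Tm Γ (nat ✶))
           (f : Tm Γ (nat ⇒ σ)) →
           Δ ⊢ LT (Y · s ^) ∣ s ∣ → Δ ⊢ 𝓗′ Y · G · H · s · f ≐ G · s
  𝓗-stop Y G H s f d = inst (∅ ▸ Y ▸ G ▸ H ▸ s ▸ f) [ LT (v₄ · v₁ ^) ∣ v₁ ∣ ]
    (𝓗′ v₄ · v₃ · v₂ · v₁ · v₀ ≐ v₃ · v₁)
    (conv {u = ifZero · ltTest (v₄ · v₁ ^) ∣ v₁ ∣ · (v₃ · v₁) · (v₂ · v₁ · v₀)} refl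
      ⨟ ·-congˡ (v₂ · v₁ · v₀) (·-congˡ (v₃ · v₁) (·-congʳ ifZero h₀))
      ⨟ conv refl)
    (d ∷ [])

  𝓗-step : (Y : Tm Γ ((nat ⇒ nat) ⇒ nat)) (m : Tm Γ nat) (G : Tm Γ 𝔾) (H : Tm Γ ℍ) (s : Tm Γ (nat ✶))
           (f : Tm Γ (nat ⇒ σ)) →
           Δ ⊢ ltTest (Y · s ^) ∣ s ∣ ≐ con suc · m → Δ ⊢ 𝓗′ Y · G · H · s · f ≐ H · s · f
  𝓗-step Y m G H s f d = inst (∅ ▸ m ▸ Y ▸ G ▸ H ▸ s ▸ f) [ ltTest (v₄ · v₁ ^) ∣ v₁ ∣ ≐ con suc · v₅ ]
    (𝓗′ v₄ · v₃ · v₂ · v₁ · v₀ ≐ v₂ · v₁ · v₀)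
    (conv {u = ifZero · ltTest (v₄ · v₁ ^) ∣ v₁ ∣ · (v₃ · v₁) · (v₂ · v₁ · v₀)} refl
      ⨟ ·-congˡ (v₂ · v₁ · v₀) (·-congˡ (v₃ · v₁) (·-congʳ ifZero h₀))
      ⨟ conv refl)
    (d ∷ [])

  -- The test Val u ŝ < |s| and the two alternatives give four cases: if u stops, Ψ with its frozen
  -- bound settles both outcomes of the test; if u steps, `𝓗′` branches on the same test.
  Good⇒Spector : [ Good v₀ ] ⊢ Spector′ {Γ = nat ° ∷ []} (Val v₀) (Φ′ (Val v₀) · 𝖡 v₀)
  Good⇒Spector = ∀I (∀I (∀I (∧I
    (⊃I (∨E (Good-elim v₃ (lam (Ψ · (Val v₄ · v₀ ^) · v₃ · v₂ · v₀)) (𝓗′ (Val v₃) · v₂ · v₁) v₀ h₁)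
      (conv refl
        ⨟ Stop⇒Ψ v₃ _ v₂ v₁ _ v₀ v₀ (∀I (conv refl)) h₀ (Ext-refl v₀)
        ⨟ Ψ-stop (Val v₃ · v₀ ^) v₂ v₁ v₀ (≺⇒LT _ _ h₁))
      (conv refl
        ⨟ h₀
        ⨟ 𝓗-stop (Val v₃) v₂ v₁ v₀ _ (≺⇒LT _ _ h₁))))
    (⊃I (∃E (≽⇒ltTest-suc (Val v₃ · v₀ ^) ∣ v₀ ∣ h₀)
      (∨E (Good-elim v₄ (lam (Ψ · (Val v₅ · v₀ ^) · v₄ · v₃ · v₀)) (𝓗′ (Val v₄) · v₃ · v₂) v₁ h₂)
        (conv refl
          ⨟ Stop⇒Ψ-step v₄ v₀ _ v₃ v₂ _ v₁ (∀I (conv refl)) h₀ h₁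
          ⨟ conv refl)
        (conv refl
          ⨟ h₀
          ⨟ 𝓗-step (Val v₄) v₀ v₃ v₂ v₁ _ h₁
          ⨟ conv refl)))))))

  Good⇒SpectorBR : (Y : Tm [] ((nat ⇒ nat) ⇒ nat)) (u : Tm [] (nat °)) →
                   [] ⊢ Y ≐ Val u → [] ⊢ Good u → [] ⊢ SpectorBR Y (Φ Y · 𝖡 u)
  Good⇒SpectorBR Y u d e = ⊢-subst
    (sym (trans (SpectorBR-closed Y _) (cong (λ f → Spector′ Y (f · 𝖡 u)) (Φ-closed Y))))
    -- The recursor itself becomes a variable with an equation as hypothesis, because its weakenings
    -- do not compute; then Y is rewritten to Val u by Leibniz substitution.
    (inst (∅ ▸ Y ▸ u ▸ Φ′ Y · 𝖡 u) (v₂ ≐ Val v₁ ∷ Good v₁ ∷ v₀ ≐ Φ′ v₂ · 𝖡 v₁ ∷ []) (Spector′ v₂ v₀)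
      (≐subst (Spector′ v₃ v₀) (≐sym h₂) (≐subst (Spector′ v₀ (Φ′ v₀ · 𝖡 v₂)) (≐sym h₀)
        (inst (∅ ▸ v₁) [ Good v₀ ] (Spector′ (Val v₀) (Φ′ (Val v₀) · 𝖡 v₀)) Good⇒Spector (h₁ ∷ []))))
      (d ∷ e ∷ ≐refl ∷ []))

  -- The logical relation

  -- α is the same parameter throughout; the last two clauses are junk, as only
  -- types built from ℕ and → occur.
  R : ∀ A → Tm Γ (nat ⇒ nat) → Tm Γ A → Tm Γ (A °) → Fm Γ
  R nat     α a u = a ≐ Val u · α ∧ Good u
  R (A ⇒ B) α f g = ∀′ A (∀′ (A °)
    (R A (wk (wk α)) v₁ v₀ ⊃ R B (wk (wk α)) (wk (wk f) · v₁) (wk (wk g) · v₀)))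
  R (A ⊗ B) α a u = ⊥′
  R (A ✶)   α a u = ⊥′

  R-≡ : {α α′ : Tm Γ (nat ⇒ nat)} {a a′ : Tm Γ A} {u u′ : Tm Γ (A °)} →
        α ≡ α′ → a ≡ a′ → u ≡ u′ → R A α a u ≡ R A α′ a′ u′
  R-≡ refl refl refl = refl

  sub-wk² : (θ : Sub Γ Γ′) (t : Tm Γ A) {B C : Ty} →
            sub (liftSub {A = B} (liftSub {A = C} θ)) (wk (wk t)) ≡ wk (wk (sub θ t))
  sub-wk² θ t = trans (sub-wk (liftSub θ) (wk t)) (cong wk (sub-wk θ t))

  subF-R : ∀ A (θ : Sub Γ Γ′) {α : Tm Γ (nat ⇒ nat)} {a : Tm Γ A} {u : Tm Γ (A °)} →
           subF θ (R A α a u) ≡ R A (sub θ α) (sub θ a) (sub θ u)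
  subF-R nat     θ {α} {a} {u} = cong (sub θ (a) ≐ Val (sub θ u) · sub θ α ∧_)
    -- `Good u` is read as the instance of `Good v₀` at u, where substitution computes.
    (trans (subF-subF θ (∅ ▸ u) (Good v₀))
      (subF-cong {θ = λ x → sub θ ((∅ ▸ u) x)} {∅ ▸ sub θ u} (λ { (here refl) → refl }) (Good v₀)))
  subF-R (A ⇒ B) θ {α} {f} {g} = cong (∀′ A) (cong (∀′ (A °)) (cong₂ _⊃_
    (trans (subF-R A (liftSub (liftSub θ))) (R-≡ (sub-wk² θ α) refl refl))
    (trans (subF-R B (liftSub (liftSub θ)))
      (R-≡ (sub-wk² θ α) (cong (_· v₁) (sub-wk² θ f)) (cong (_· v₀) (sub-wk² θ g))))))
  subF-R (A ⊗ B) θ = refl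
  subF-R (A ✶)   θ = refl

  R-wk : ∀ A {Δ′ : List (Fm (B ∷ Γ))} {α : Tm Γ (nat ⇒ nat)} {a : Tm Γ A} {u : Tm Γ (A °)} →
         map wkF Δ ⊆ Δ′ → Δ ⊢ R A α a u → Δ′ ⊢ R A (wk α) (wk a) (wk u)
  R-wk A i d = ⊢-subst (trans (renF-as-subF there _) (trans (subF-R A (var ∘ there))
    (R-≡ (sym (ren-as-sub there _)) (sym (ren-as-sub there _)) (sym (ren-as-sub there _))))) (wk-⊢ i d)

  R-cong : ∀ A {α : Tm Γ (nat ⇒ nat)} {a a′ : Tm Γ A} {u u′ : Tm Γ (A °)} →
           Δ ⊢ a ≐ a′ → Δ ⊢ u ≐ u′ → Δ ⊢ R A α a u → Δ ⊢ R A α a′ u′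
  R-cong A {α} {a} {a′} {u} {u′} d e f = replaceʳ (replaceˡ f)
    where
    replaceˡ : _ ⊢ R A α a u → _ ⊢ R A α a′ u
    replaceˡ f = ⊢-subst (trans (subF-R A (single a′)) (R-≡ (single-wk a′ α) refl (single-wk a′ u)))
      (≐subst (R A (wk α) v₀ (wk u)) d
        (⊢-subst (sym (trans (subF-R A (single a)) (R-≡ (single-wk a α) refl (single-wk a u)))) f))
    replaceʳ : _ ⊢ R A α a′ u → _ ⊢ R A α a′ u′
    replaceʳ f = ⊢-subst (trans (subF-R A (single u′)) (R-≡ (single-wk u′ α) (single-wk u′ a′) refl))
      (≐subst (R A (wk α) (wk a′) v₀) e
        (⊢-subst (sym (trans (subF-R A (single u)) (R-≡ (single-wk u α) (single-wk u a′) refl))) f))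

  R-intro : {α : Tm Γ (nat ⇒ nat)} {f : Tm Γ (A ⇒ B)} {g : Tm Γ ((A ⇒ B) °)} →
            R A (wk (wk α)) v₁ v₀ ∷ map wkF (map wkF Δ)
              ⊢ R B (wk (wk α)) (wk (wk f) · v₁) (wk (wk g) · v₀) →
            Δ ⊢ R (A ⇒ B) α f g
  R-intro d = ∀I (∀I (⊃I d))

  R-elim : ∀ A B {α : Tm Γ (nat ⇒ nat)} {f : Tm Γ (A ⇒ B)} {g : Tm Γ ((A ⇒ B) °)}
           {a : Tm Γ A} {u : Tm Γ (A °)} →
           Δ ⊢ R (A ⇒ B) α f g → Δ ⊢ R A α a u → Δ ⊢ R B α (f · a) (g · u)
  R-elim {Γ = Γ} {Δ = Δ} A B {α} {f} {g} {a} {u} d e = ⊃E (⊢-subst eq (∀E (∀E d a) u)) e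
    where
    θ : Sub (A ° ∷ A ∷ Γ) Γ
    θ x = sub (single u) (liftSub (single a) x)

    θ-wk² : ∀ {C} (t : Tm Γ C) → sub θ (wk (wk t)) ≡ t
    θ-wk² t = trans (sub-ren θ there (wk t)) (trans (sub-ren (θ ∘ there) there t) (sub-var (λ _ → refl) t))

    eq : subF (single u) (subF (liftSub (single a))
           (R A (wk (wk α)) v₁ v₀ ⊃ R B (wk (wk α)) (wk (wk f) · v₁) (wk (wk g) · v₀)))
         ≡ (R A α a u ⊃ R B α (f · a) (g · u))
    eq = trans (subF-subF (single u) (liftSub (single a)) _) (cong₂ _⊃_
      (trans (subF-R A θ) (R-≡ (θ-wk² α) (single-wk u a) refl))
      (trans (subF-R B θ) (R-≡ (θ-wk² α) (cong₂ _·_ (θ-wk² f) (single-wk u a)) (cong (_· u) (θ-wk² g)))))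

  R-zero : (α : Tm Γ (nat ⇒ nat)) → Δ ⊢ R nat α (con zero) zeroᵒ
  R-zero α = inst (∅ ▸ α) [] (R nat v₀ (con zero) zeroᵒ)
    (∧I (conv refl) (inst ∅ [] (Good zeroᵒ) Good-zero [])) []

  -- `n` is any term of HAω, not an external number, as the internal induction for the recursor
  -- needs.
  R-num : (α : Tm Γ (nat ⇒ nat)) (n : Tm Γ nat) → Δ ⊢ R nat α n (numᵒ · n)
  R-num α n = inst (∅ ▸ α ▸ n) [] (R nat v₁ v₀ (numᵒ · v₀))
    (∧I (conv refl) (inst (∅ ▸ v₀) [] (Good (numᵒ · v₀)) Good-num [])) []

  R-suc : (α : Tm Γ (nat ⇒ nat)) → Δ ⊢ R (nat ⇒ nat) α (con suc) sucᵒ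
  R-suc α = inst (∅ ▸ α) [] (R (nat ⇒ nat) v₀ (con suc) sucᵒ)
    (R-intro (∧I (·-congʳ (con suc) (∧E₁ h₀) ⨟ conv refl)
      (inst (∅ ▸ v₀) [ Good v₀ ] (Good (sucᵒ · v₀)) Good-suc (∧E₂ h₀ ∷ [])))) []

  R-α : (α : Tm Γ (nat ⇒ nat)) → Δ ⊢ R (nat ⇒ nat) α α αᵒ
  R-α α = inst (∅ ▸ α) [] (R (nat ⇒ nat) v₀ v₀ αᵒ)
    (R-intro (∧I (·-congʳ v₂ (∧E₁ h₀) ⨟ conv refl)
      (inst (∅ ▸ v₀) [ Good v₀ ] (Good (αᵒ · v₀)) Good-α (∧E₂ h₀ ∷ [])))) []

  -- The recursor

  -- `recBody` is defined by recursion on the type, so its closedness takes an induction too.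
  sub-recBody : (p : Pure η) (θ : Sub Γ Γ′) → sub θ (recBody p) ≡ recBody p
  sub-recBody natᵖ     θ = refl
  sub-recBody (p ⇒ᵖ q) θ =
    cong (λ b → lam (lam (lam (b · v₂ · lam (v₂ · v₀ · v₁))))) (sub-recBody q _)

  sub-recᵒ : (p : Pure η) (θ : Sub Γ Γ′) → sub θ (recᵒ p) ≡ recᵒ p
  sub-recᵒ p θ = cong (λ b → lam (lam (lam
    (b · v₀ · lam (con (rec _) · v₃ · lam (v₃ · (numᵒ · v₀)) · v₀))))) (sub-recBody p _)

  wk-recBody : (p : Pure η) → wk {Γ} {B = B} (recBody p) ≡ recBody p
  wk-recBody p = trans (ren-as-sub there (recBody p)) (sub-recBody p _)

  wk³-recBody : (p : Pure η) {C D E : Ty} → wk {B = C} (wk {B = D} (wk {Γ} {B = E} (recBody p))) ≡ recBody p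
  wk³-recBody p = trans (cong (wk ∘ wk) (wk-recBody p)) (trans (cong wk (wk-recBody p)) (wk-recBody p))

  recBody-⇒ : (p : Pure A) (q : Pure B) (x : Tm Γ (nat °)) (r : Tm Γ (nat ⇒ (A ⇒ B) °)) (v : Tm Γ (A °)) →
              Δ ⊢ recBody (p ⇒ᵖ q) · x · r · v ≐ recBody q · x · lam (wk r · v₀ · wk v)
  recBody-⇒ p q x r v = ≐-≡
    (cong (λ b → lam (lam (lam (b · v₂ · lam (v₂ · v₀ · v₁)))) · x · r · v) (wk³-recBody q)) refl
    -- `recBody q` is replaced by a variable, which normalisation leaves alone, and put back by the
    -- instance.
    (inst (∅ ▸ recBody q ▸ x ▸ r ▸ v) []
      (lam (lam (lam (v₆ · v₂ · lam (v₂ · v₀ · v₁)))) · v₂ · v₁ · v₀ ≐ v₃ · v₂ · lam (v₂ · v₀ · v₁))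
      (conv refl) [])

  recᵒ-β : (p : Pure η) (a : Tm Γ (η °)) (F : Tm Γ (nat ° ⇒ η ° ⇒ η °)) (x : Tm Γ (nat °)) →
           Δ ⊢ recᵒ p · a · F · x
               ≐ recBody p · x · lam (con (rec (η °)) · wk a · lam (wk (wk F) · (numᵒ · v₀)) · v₀)
  recᵒ-β p a F x = ≐-≡
    (cong (λ b → lam (lam (lam (b · v₀ · lam (con (rec _) · v₃ · lam (v₃ · (numᵒ · v₀)) · v₀)))) · a · F · x)
      (wk³-recBody p)) refl
    (inst (∅ ▸ recBody p ▸ a ▸ F ▸ x) []
      (lam (lam (lam (v₆ · v₀ · lam (con (rec _) · v₃ · lam (v₃ · (numᵒ · v₀)) · v₀)))) · v₂ · v₁ · v₀
        ≐ v₃ · v₀ · lam (con (rec _) · v₃ · lam (v₃ · (numᵒ · v₀)) · v₀))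
      (conv refl) [])

  -- Both families are indexed by the same plain number: the translated recursor counts along
  -- values, not along elements of ℕ°.
  Rω : ∀ η → Tm Γ (nat ⇒ nat) → Tm Γ (nat ⇒ η) → Tm Γ (nat ⇒ η °) → Fm Γ
  Rω η α r′ r = ∀′ nat (R η (wk α) (wk r′ · v₀) (wk r · v₀))

  subF-Rω : (θ : Sub Γ Γ′) {α : Tm Γ (nat ⇒ nat)} {r′ : Tm Γ (nat ⇒ η)} {r : Tm Γ (nat ⇒ η °)} →
            subF θ (Rω η α r′ r) ≡ Rω η (sub θ α) (sub θ r′) (sub θ r)
  subF-Rω θ {α} {r′} {r} = cong (∀′ nat) (trans (subF-R _ (liftSub θ))
    (R-≡ (sub-wk θ α) (cong (_· v₀) (sub-wk θ r′)) (cong (_· v₀) (sub-wk θ r))))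

  Rω-elim : {α : Tm Γ (nat ⇒ nat)} {r′ : Tm Γ (nat ⇒ η)} {r : Tm Γ (nat ⇒ η °)} →
            Δ ⊢ Rω η α r′ r → (n : Tm Γ nat) → Δ ⊢ R η α (r′ · n) (r · n)
  Rω-elim d n = ⊢-subst (trans (subF-R _ (single n))
    (R-≡ (single-wk n _) (cong (_· n) (single-wk n _)) (cong (_· n) (single-wk n _)))) (∀E d n)

  Rω-≡ : {α α₁ : Tm Γ (nat ⇒ nat)} {r′ r′₁ : Tm Γ (nat ⇒ η)} {r r₁ : Tm Γ (nat ⇒ η °)} →
         α ≡ α₁ → r′ ≡ r′₁ → r ≡ r₁ → Rω η α r′ r ≡ Rω η α₁ r′₁ r₁
  Rω-≡ refl refl refl = refl

  Rω-wk : {Δ′ : List (Fm (B ∷ Γ))} {α : Tm Γ (nat ⇒ nat)}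
          {r′ : Tm Γ (nat ⇒ η)} {r : Tm Γ (nat ⇒ η °)} →
          map wkF Δ ⊆ Δ′ → Δ ⊢ Rω η α r′ r → Δ′ ⊢ Rω η (wk α) (wk r′) (wk r)
  Rω-wk i d = ⊢-subst (trans (renF-as-subF there _) (trans (subF-Rω (var ∘ there))
    (Rω-≡ (sym (ren-as-sub there _)) (sym (ren-as-sub there _)) (sym (ren-as-sub there _))))) (wk-⊢ i d)

  -- Induction on the type: arguments are absorbed into the family, as in `recBody`, until
  -- `Good-rec` applies at ℕ.
  R-recBody : (p : Pure η) (α : Tm Γ (nat ⇒ nat)) (x′ : Tm Γ nat) (x : Tm Γ (nat °))
              (r′ : Tm Γ (nat ⇒ η)) (r : Tm Γ (nat ⇒ η °)) →
              Δ ⊢ R nat α x′ x → Δ ⊢ Rω η α r′ r → Δ ⊢ R η α (r′ · x′) (recBody p · x · r)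
  R-recBody natᵖ α x′ x r′ r d e = inst (∅ ▸ α ▸ x′ ▸ x ▸ r′ ▸ r)
    (R nat v₄ v₃ v₂ ∷ Rω nat v₄ v₁ v₀ ∷ []) (R nat v₄ (v₁ · v₃) (recBody natᵖ · v₂ · v₀))
    -- x′ equals Val x α, which is the stage that the translation evaluates, so the families are
    -- compared there.
    (∧I (·-congʳ v₁ (∧E₁ h₀) ⨟ ∧E₁ (∀E h₁ (Val v₂ · v₄)) ⨟ conv refl)
      (inst (∅ ▸ v₂ ▸ v₀) (Good v₁ ∷ ∀′ nat (Good (v₁ · v₀)) ∷ []) (Good (recBody natᵖ · v₁ · v₀))
        Good-rec (∧E₂ h₀ ∷ ∀I (∧E₂ (∀E h₁ v₀)) ∷ [])))
    (d ∷ e ∷ [])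
  R-recBody {η = A ⇒ B} (p ⇒ᵖ q) α x′ x r′ r d e = R-intro (R-cong B
    (inst (∅ ▸ wk (wk x′) ▸ wk (wk r′) ▸ v₁) [] (lam (v₂ · v₀ · v₁) · v₂ ≐ v₁ · v₂ · v₀) (conv refl) [])
    (≐-≡ refl (cong (λ b → b · wk (wk x) · wk (wk r) · v₀) (sym (wk²-recBody (p ⇒ᵖ q))))
      (≐sym (recBody-⇒ p q (wk (wk x)) (wk (wk r)) v₀)))
    (R-recBody q (wk (wk α)) (wk (wk x′)) (wk (wk x))
      (lam (wk (wk (wk r′)) · v₀ · v₂)) (lam (wk (wk (wk r)) · v₀ · v₁))
      (R-wk nat there (R-wk nat id d))
      (∀I (R-cong B (≐sym wk-lam-β) (≐sym wk-lam-β)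
        (R-elim A B (Rω-elim (Rω-wk id (Rω-wk there (Rω-wk id e))) v₀) (R-wk A id h₀))))))
    where
    wk²-recBody : ∀ {Γ η C D} (p : Pure η) → wk {B = C} (wk {Γ} {B = D} (recBody p)) ≡ recBody p
    wk²-recBody p = trans (cong wk (wk-recBody p)) (wk-recBody p)

  -- `r` is known only through its recursion equations. The induction is internal, on the formula
  -- `R η`, and its step applies `F` to the numeral n° by `R-num`.
  Rω-rec : ∀ η {α : Tm Γ (nat ⇒ nat)} {a′ : Tm Γ η} {a : Tm Γ (η °)}
           {F′ : Tm Γ (nat ⇒ η ⇒ η)} {F : Tm Γ ((nat ⇒ η ⇒ η) °)} {r : Tm Γ (nat ⇒ η °)} →
           Δ ⊢ r · con zero ≐ a →
           (∀ {Δ} → Δ ⊢ wk r · (con suc · v₀) ≐ wk F · (numᵒ · v₀) · (wk r · v₀)) →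
           Δ ⊢ R η α a′ a → Δ ⊢ R (nat ⇒ η ⇒ η) α F′ F →
           Δ ⊢ Rω η α (con (rec η) · a′ · F′) r
  Rω-rec {Γ = Γ} η {α} {a′} {a} {F′} {F} {r} r-zero r-suc d e = nat-ind _
    (⊢-subst (sym (trans (subF-R η (single (con zero))) (R-≡ (single-wk _ α)
        (cong (_· con zero) (single-wk _ (con (rec η) · a′ · F′))) (cong (_· con zero) (single-wk _ r)))))
      (R-cong η (≐sym rec-zero) (≐sym r-zero) d))
    (∀I (⊃I (⊢-subst (sym (trans (subF-R η sucSub) (R-≡ (sucSub-wk α)
        (cong (_· (con suc · v₀)) (sucSub-wk (con (rec η) · a′ · F′))) (cong (_· (con suc · v₀)) (sucSub-wk r)))))
      (R-cong η (≐sym rec-suc) (≐sym r-suc)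
        (R-elim η η (R-elim nat (η ⇒ η) (R-wk (nat ⇒ η ⇒ η) there e) (R-num _ v₀)) h₀)))))
    where
    sucSub-wk : ∀ {A} (t : Tm Γ A) → sub sucSub (wk t) ≡ wk t
    sucSub-wk t = trans (sub-ren sucSub there t) (sym (ren-as-sub there t))

  R-rec : (p : Pure η) (α : Tm Γ (nat ⇒ nat)) →
          Δ ⊢ R (η ⇒ (nat ⇒ η ⇒ η) ⇒ nat ⇒ η) α (con (rec η)) (recᵒ p)
  -- The variables v₅, v₃, v₁ are the arguments a, F, x, and v₄, v₂, v₀ their translations.
  R-rec {η = η} p α = R-intro (R-intro (R-intro (R-cong η ≐refl
    (≐sym (≐-≡ (cong (λ b → b · v₄ · v₂ · v₀) (sym wk⁶-recᵒ)) refl (recᵒ-β p v₄ v₂ v₀)))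
    (R-recBody p _ v₁ v₀ (con (rec η) · v₅ · v₃)
      (lam (con (rec (η °)) · v₅ · lam (v₄ · (numᵒ · v₀)) · v₀)) h₀
      (Rω-rec η (conv refl) (conv refl)
        (R-wk η there (R-wk η id (R-wk η there (R-wk η id h₀))))
        (R-wk (nat ⇒ η ⇒ η) there (R-wk (nat ⇒ η ⇒ η) id h₀)))))))
    where
    wk-recᵒ : ∀ {Γ B} → wk {Γ} {B = B} (recᵒ p) ≡ recᵒ p
    wk-recᵒ = trans (ren-as-sub there (recᵒ p)) (sub-recᵒ p _)

    wk⁶-recᵒ : ∀ {Γ A B C D E F} →
      wk {B = A} (wk {B = B} (wk {B = C} (wk {B = D} (wk {B = E} (wk {Γ} {B = F} (recᵒ p)))))) ≡ recᵒ p
    wk⁶-recᵒ = trans (cong wk (trans (cong wk (trans (cong wk (trans (cong wk (trans (cong wk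
      wk-recᵒ) wk-recᵒ)) wk-recᵒ)) wk-recᵒ)) wk-recᵒ)) wk-recᵒ

  -- The fundamental lemma and the bar recursion equations.

  translate-wk : ∀ Γ {A B} (q : Pure A) (x : A ∈ Γ ++ [ nat ⇒ nat ]) →
                 translate (B ∷ Γ) (varᵖ q (there x)) ≡ wk (translate Γ (varᵖ q x))
  translate-wk Γ q x with ∈-++⁻ Γ x
  ... | inj₁ y           = refl
  ... | inj₂ (here refl) = refl

  -- Induction on the term. The premise on variables covers α as well: it is a variable of the
  -- source, but its translation is the closed `αᵒ`.
  fundamental : ∀ Γ {A Ξ} {Δ : List (Fm Ξ)} {t : Tm (Γ ++ [ nat ⇒ nat ]) A} (p : PureTm t)
    (α : Tm Ξ (nat ⇒ nat)) (θ : Sub (Γ ++ [ nat ⇒ nat ]) Ξ) (θᵒ : Sub (map _° Γ) Ξ) →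
    (∀ {A} (q : Pure A) x → Δ ⊢ R A α (θ x) (sub θᵒ (translate Γ (varᵖ q x)))) →
    Δ ⊢ R A α (sub θ t) (sub θᵒ (translate Γ p))
  fundamental Γ (varᵖ q x) α θ θᵒ env = env q x
  fundamental Γ {Ξ = Ξ} {Δ} (lamᵖ {A} {B} {t} _ p) α θ θᵒ env = R-intro (R-cong B
    (≐sym (wk²-lam-β θ t v₁)) (≐sym (wk²-lam-β θᵒ (translate (A ∷ Γ) p) v₀))
    (fundamental (A ∷ Γ) p (wk (wk α)) ((λ x → wk (wk (θ x))) ▸ v₁) θ⁺ env⁺))
    where
    θ⁺ : Sub (map _° (A ∷ Γ)) (A ° ∷ A ∷ Ξ)
    θ⁺ = (λ x → wk (wk (θᵒ x))) ▸ v₀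

    θ⁺-wk : ∀ {C} (u : Tm (map _° Γ) C) → sub θ⁺ (wk u) ≡ wk (wk (sub θᵒ u))
    θ⁺-wk u = trans (sub-ren θ⁺ there u)
      (sym (trans (cong wk (ren-sub there θᵒ u)) (ren-sub there (wk ∘ θᵒ) u)))

    env⁺ : ∀ {C} (q : Pure C) x → R A (wk (wk α)) v₁ v₀ ∷ map wkF (map wkF Δ) ⊢
           R C (wk (wk α)) (((λ x → wk (wk (θ x))) ▸ v₁) x) (sub θ⁺ (translate (A ∷ Γ) (varᵖ q x)))
    env⁺ q (here refl) = h₀
    env⁺ q (there x) = ⊢-subst
      (R-≡ refl refl (sym (trans (cong (sub θ⁺) (translate-wk Γ q x)) (θ⁺-wk (translate Γ (varᵖ q x))))))
      (R-wk _ there (R-wk _ id (env q x)))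
  fundamental Γ (_·ᵖ_ {A} {B} p q) α θ θᵒ env =
    R-elim A B (fundamental Γ p α θ θᵒ env) (fundamental Γ q α θ θᵒ env)
  fundamental Γ zeroᵖ α θ θᵒ env = R-zero α
  fundamental Γ sucᵖ α θ θᵒ env = R-suc α
  fundamental Γ (recᵖ p) α θ θᵒ env =
    ⊢-subst (R-≡ refl refl (sym (sub-recᵒ p θᵒ))) (R-rec p α)

  R-translate : {t : Tm [ nat ⇒ nat ] nat} (p : PureTm t) {Δ : List (Fm Γ)} (α : Tm Γ (nat ⇒ nat)) →
                Δ ⊢ R nat α (sub (∅ ▸ α) t) (sub ∅ (translate [] p))
  R-translate p α = fundamental [] p α (∅ ▸ α) ∅ (λ { q (here refl) → R-α α })

  translate-spector : {t : Tm [ nat ⇒ nat ] nat} (p : PureTm t) →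
                      [] ⊢ SpectorBR (lam t) (Φ (lam t) · 𝖡 (translate [] p))
  translate-spector {t} p = Good⇒SpectorBR (lam t) (translate [] p)
    -- The relation at a generic α, the variable bound by `∀I`, yields the equality by
    -- extensionality.
    (≐ext (∀I (wk-lam-β ⨟ ≐-≡ (sub-var (λ { (here refl) → refl }) t)
        (cong (λ u → Val u · v₀) (trans (sub-cong (λ ()) u) (sym (ren-as-sub there u))))
        (∧E₁ (R-translate p v₀)))))
    -- Goodness does not mention α, so the zero sequence serves as parameter.
    (⊢-subst (cong Good (sub-var (λ ()) u)) (∧E₂ (R-translate p (lam (con zero)))))
    where u = translate [] p

  -- Levels

  -- The dominant argument of `𝔹` is `ℍ`, of level 1 + max(1, level σ) owing to its own argument of
  -- type ℕ → σ.
  level-𝔹 : level 𝔹 ≤ 2 + (1 ⊔ level σ)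
  level-𝔹 = ⊔-lub (n≤1+n _) (⊔-lub
    (s≤s (⊔-lub (s≤s z≤n) (⊔-lub ≤-refl (m≤n⇒m≤1+n (m≤n⊔m 1 (level σ))))))
    (m≤n⇒m≤1+n (n≤1+n _)))

  -- The bound at ℕ° is 2 + max(1, level σ), and each arrow raises both sides alike; this is the
  -- source of the constant in j.
  level-° : Pure η → level (η °) ≤ 2 + (1 ⊔ level σ) + level η
  level-° natᵖ = ≤-trans (⊔-lub (s≤s (s≤s z≤n)) level-𝔹) (m≤m+n _ 0)
  level-° (_⇒ᵖ_ {A} {B} p q) = ⊔-lub
    (≤-trans (s≤s (level-° p)) (≤-trans (≤-reflexive (sym (+-suc (2 + (1 ⊔ level σ)) (level A))))
      (+-monoʳ-≤ (2 + (1 ⊔ level σ)) (m≤m⊔n (suc (level A)) (level B)))))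
    (≤-trans (level-° q) (+-monoʳ-≤ (2 + (1 ⊔ level σ)) (m≤n⊔m (suc (level A)) (level B))))

  module _ (i : ℕ) where
    j : ℕ
    j = 2 + (1 ⊔ level σ) + i

    1⊔σ≤j : 1 ⊔ level σ ≤ j
    1⊔σ≤j = ≤-trans (m≤n⇒m≤1+n (n≤1+n _)) (m≤m+n _ i)

    σ≤j : level σ ≤ j
    σ≤j = ≤-trans (m≤n⊔m 1 (level σ)) 1⊔σ≤j

    -- ∈T does not depend on the context of a concrete term, hence the choice [].
    Ψ-levels : All (λ B → level B ≤ j) (recTypes (Ψ {[]}))
    Ψ-levels = σ≤j ∷ z≤n ∷ z≤n ∷ 1⊔σ≤j ∷ z≤n ∷ z≤n ∷ []

    recBody-∈T : (p : Pure η) → recBody {Γ} p ∈T j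
    recBody-∈T natᵖ     = ∈T-recTypes {i = j} (recBody {[]} natᵖ) []
    recBody-∈T (p ⇒ᵖ q) = (recBody-∈T q , tt) , ((tt , tt) , tt)

    translate-∈T : ∀ Γ {t : Tm (Γ ++ [ nat ⇒ nat ]) A} (p : PureTm t) → t ∈T i → translate Γ p ∈T j
    translate-∈T Γ (varᵖ q x) l with ∈-++⁻ Γ x
    ... | inj₁ y           = tt
    ... | inj₂ (here refl) = ∈T-recTypes (αᵒ {[]}) Ψ-levels
    translate-∈T Γ (lamᵖ {A} _ p) l = translate-∈T (A ∷ Γ) p l
    translate-∈T Γ (p ·ᵖ q) (l , m) = translate-∈T Γ p l , translate-∈T Γ q m
    translate-∈T Γ zeroᵖ l = ∈T-recTypes {i = j} (zeroᵒ {[]}) []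
    translate-∈T Γ sucᵖ l = ∈T-recTypes {i = j} (sucᵒ {[]}) []
    -- The only clause where a recursor of t changes its type: level η ≤ i becomes level (η °) ≤ j.
    translate-∈T Γ (recᵖ p) l =
      (recBody-∈T p , tt) ,
      (((≤-trans (level-° p) (+-monoʳ-≤ (2 + (1 ⊔ level σ)) l) , tt) ,
        tt , ∈T-recTypes {i = j} (numᵒ {[]}) [] , tt) , tt)

    -- For unknown Y the list of recursors does not compute, so the bound is assembled along the
    -- term, with those of Y bounded by i ≤ j.
    Φ-∈T : (Y : Tm [] ((nat ⇒ nat) ⇒ nat)) → Y ∈T i → Φ Y ∈T j
    Φ-∈T Y l =
      ((tt , (((∈T-recTypes (Ψ {[]}) Ψ-levels , Y∈T , tt , tt) , tt) , tt) , tt) ,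
       ((((∈T-recTypes (ifZero {[]} {σ}) (σ≤j ∷ []) ,
          (∈T-recTypes (monus {[]}) (z≤n ∷ z≤n ∷ []) , tt , Y∈T , tt , tt) , tt , tt) ,
          tt , tt) , (tt , tt) , tt) , tt) , tt) , tt
      where
      Y∈T : ∀ {Γ} → closed {Γ} Y ∈T j
      Y∈T = ren-∈T (m≤n+m i _) (λ ()) Y l

corollary3p5 : (σ : Ty) (t : Tm [ nat ⇒ nat ] nat) (p : PureTm t) →
    let open Translation σ
        ξ : Tm [] 𝔹
        ξ = Φ (lam t) · 𝖡 (translate [] p)
    in ([] ⊢ SpectorBR (lam t) ξ)
     × ((i : ℕ) → t ∈T i → ξ ∈T (2 + (1 ⊔ level σ) + i))
corollary3p5 σ t p = translate-spector σ p , λ i l →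
  Φ-∈T σ i (lam t) l , tt , translate-∈T σ i [] p l
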